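{- Let $q=e^{2\pi i\tau}$, $t(\tau)=\eta(3\tau)^{12}/\eta(\tau)^{12}$ and $B_n=(-1)^nA_n$, where $A_n=27^n[z^n]\,{}_2F_1(\tfrac13,\tfrac13;1;z)^3$. Then \[ \sum_{n\ge0}B_n\,t(\tau)^n=\frac{\eta(\tau)^9}{\eta(3\tau)^3}. \] Consequently, with $C(q):=\Bigl(\sum_{n\ge0}B_nt^n\Bigr)\cdot\frac{q}{t}\cdot\frac{dt}{dq}$, one has $C(q)=3E_{5,\chi_0,\chi_3}(\tau)$, and writing $C(q)=1+\sum_{n\ge1}c_nq^n$, \[ c_n=3\sum_{d\mid n}\chi_3(d)d^4. \]
   Context: $\eta(\tau)=q^{1/24}\prod_{n\ge1}(1-q^n)$ is the Dedekind eta function. $\chi_3(n)=\left(\frac{n}{3}\right)$ and $\chi_0$ is the trivial character. $E_{5,\chi_0,\chi_3}$ denotes the weight-5 Eisenstein series on $\Gamma_0(3)$ with character $\chi_3$, normalized to have constant term $1/3$ times... more precisely normalized so that its $n$-th Fourier coefficient ($n\ge1$) is $\sum_{d\mid n}\chi_3(d)d^4$ and $3E_{5,\chi_0,\chi_3}$ has constant term $1$. -}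

module Defs where

open import Data.Nat as ℕ using (ℕ; zero; suc)
open import Data.Nat.Divisibility using (_∣?_)
open import Data.Integer using (ℤ; +_)
open import Data.Rational using (ℚ; 0ℚ; 1ℚ; _+_; _*_; -_; _/_)
open import Data.List using (List; []; _∷_; _++_; [_])
open import Relation.Nullary using (yes; no)

Series : Set
Series = ℕ → ℚ

ℕtoℚ : ℕ → ℚ
ℕtoℚ n = (+ n) / 1

sumTo : ℕ → (ℕ → ℚ) → ℚ
sumTo zero    f = f 0
sumTo (suc n) f = sumTo n f + f (suc n)

sum1To : ℕ → (ℕ → ℚ) → ℚ
sum1To zero    f = 0ℚ
sum1To (suc n) f = sum1To n f + f (suc n)

_⊛_ : Series → Series → Series
(f ⊛ g) n = sumTo n (λ k → f k * g (n ℕ.∸ k))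

oneS : Series
oneS zero    = 1ℚ
oneS (suc n) = 0ℚ

powS : Series → ℕ → Series
powS f zero    = oneS
powS f (suc e) = f ⊛ powS f e

oneMinusQ : ℕ → Series
oneMinusQ m n with n ℕ.≟ 0 | n ℕ.≟ m
... | yes _ | _     = 1ℚ
... | no _  | yes _ = - 1ℚ
... | no _  | no _  = 0ℚ

-- 1/(1 - q^m) = Σ_j q^{m j}, for m ≥ 1
geomQ : ℕ → Series
geomQ m n with m ∣? n
... | yes _ = 1ℚ
... | no _  = 0ℚ

prodTo : ℕ → (ℕ → Series) → Series
prodTo zero    F = oneS
prodTo (suc N) F = prodTo N F ⊛ F (suc N)

-- Infinite product Π_{k≥1} F k, where F k ≡ 1 mod q^k: the q^N coefficient
-- only depends on the factors with k ≤ N.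
prodInf : (ℕ → Series) → Series
prodInf F N = prodTo N F N

etaProdPos : ℕ → ℕ → Series
etaProdPos m e = prodInf (λ k → powS (oneMinusQ (m ℕ.* k)) e)

etaProdNeg : ℕ → ℕ → Series
etaProdNeg m e = prodInf (λ k → powS (geomQ (m ℕ.* k)) e)

shiftUp : Series → Series
shiftUp f zero    = 0ℚ
shiftUp f (suc n) = f n

-- division by q (for series with zero constant term)
shiftDown : Series → Series
shiftDown f n = f (suc n)

derivS : Series → Series
derivS f n = ℕtoℚ (suc n) * f (suc n)

-- Multiplicative inverse of a power series u with constant term 1:
-- v 0 = 1,  v n = - Σ_{k=1}^{n} u k * v (n-k).
lookupD : List ℚ → ℕ → ℚ
lookupD []       _       = 0ℚ
lookupD (x ∷ xs) zero    = x
lookupD (x ∷ xs) (suc n) = lookupD xs n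

invList : Series → ℕ → List ℚ
invList u zero    = [ 1ℚ ]
invList u (suc n) =
  invList u n ++ [ - sum1To (suc n) (λ k → u k * lookupD (invList u n) (suc n ℕ.∸ k)) ]

invUnit : Series → Series
invUnit u n = lookupD (invList u n) n

-- t(τ) = η(3τ)^12/η(τ)^12 = q Π (1-q^{3n})^12 / Π (1-q^n)^12
tS : Series
tS = shiftUp (etaProdPos 3 12 ⊛ etaProdNeg 1 12)

-- η(τ)^9/η(3τ)^3 = Π (1-q^n)^9 / Π (1-q^{3n})^3   (q-power (9-9)/24 = 0)
etaQuot : Series
etaQuot = etaProdPos 1 9 ⊛ etaProdNeg 3 3

-- Hypergeometric 2F1(1/3,1/3;1;z): [z^k] = ((1/3)_k / k!)^2
--   (1/3)_k / k! = Π_{j<k} (j + 1/3)/(j+1) = Π_{j<k} (3j+1)/(3(j+1))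
pochRatio : ℕ → ℚ
pochRatio zero    = 1ℚ
pochRatio (suc j) = pochRatio j * ((+ (3 ℕ.* j ℕ.+ 1)) / (3 ℕ.* suc j))

F21 : Series
F21 k = pochRatio k * pochRatio k

A : ℕ → ℚ
A n = ℕtoℚ (27 ℕ.^ n) * powS F21 3 n

signℚ : ℕ → ℚ
signℚ zero    = 1ℚ
signℚ (suc n) = - signℚ n

B : ℕ → ℚ
B n = signℚ n * A n

-- Σ_{n≥0} B_n t^n ; since t has no constant term, the q^N coefficient
-- only involves n ≤ N.
composeS : (ℕ → ℚ) → Series → Series
composeS b t N = sumTo N (λ n → b n * powS t n N)

BofT : Series
BofT = composeS B tS

-- C(q) = (Σ B_n t^n) · (q/t) · dt/dq ; q/t = 1/(t/q)
CS : Series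
CS = (BofT ⊛ invUnit (shiftDown tS)) ⊛ derivS tS

χ3 : ℕ → ℚ
χ3 d with d ℕ.% 3
... | 1 = 1ℚ
... | 2 = - 1ℚ
... | _ = 0ℚ

divSum : ℕ → ℚ
divSum n = sum1To n (λ d → term d)
  where
  term : ℕ → ℚ
  term d with d ∣? n
  ... | yes _ = χ3 d * ℕtoℚ (d ℕ.^ 4)
  ... | no _  = 0ℚ

E5 : Series
E5 zero    = (+ 1) / 3
E5 (suc n) = divSum (suc n)

{-# OPTIONS --safe #-}

-- Put s = q(dt/dq)/t and β = q d/dq log(η(τ)³/η(3τ)), which are Lambert series by logarithmic
-- differentiation. As the derivative of Σ c(n)tⁿ is s Σ n c(n)tⁿ, the hypergeometric equation says
-- that Φ = ₂F₁(1/3,1/3;1;-27t) satisfies q dΦ/dq = βΦ, provided that s and β satisfy a system of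
-- quadratic differential equations; then Φ³ and η(τ)⁹/η(3τ)³ both have logarithmic derivative 3β.
-- Likewise W = 1 - 9 Σ χ₃(d)d²q^{dk} equals η(τ)⁹/η(3τ)³ because W has logarithmic derivative 3β, and
-- C = sW. All this is reduced to six identities that express a product of two Lambert series by
-- single Lambert series and their derivatives. They are instances of Liouville's elementary method:
-- with G_d = q^d/(1-q^d) one has G_d G_e = G_{d+e}(1 + G_d + G_e), so that a sum Σ T(d,e) G_d G_e
-- collapses to single sums when T(d,e) = g(d,e) - g(d,d+e) for symmetric g and T.
module Submission where

open import Defs
open import Data.Nat as ℕ using (ℕ; zero; suc; _∸_; _≤_; _<_; z≤n; s≤s)
import Data.Nat.Properties as ℕₚ
open import Data.Nat.Divisibility using (_∣?_; ∣⇒≤; _∣0; ∣m+n∣m⇒∣n; ∣m∣n⇒∣m+n; ∣-refl)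
open import Data.Nat.DivMod using ([m+n]%n≡m%n)
open import Data.Nat.Induction using (<-rec)
open import Data.Integer as ℤ using ()
import Data.Integer.Properties as ℤₚ
open import Data.Rational using (ℚ; 0ℚ; 1ℚ; _+_; _*_; -_; _-_; _/_; toℚᵘ)
open import Data.Rational.Properties as ℚₚ
  using (+-assoc; +-comm; +-identityˡ; +-identityʳ; +-inverseˡ; +-inverseʳ;
         *-assoc; *-comm; *-identityˡ; *-identityʳ; *-zeroˡ; *-zeroʳ; *-distribˡ-+; *-distribʳ-+)
open import Data.Rational.Unnormalised as ℚᵘ using (mkℚᵘ; *≡*)
import Data.Rational.Unnormalised.Properties as ℚᵘₚ
open import Data.Rational.Solver using (module +-*-Solver)
open import Data.Fin using (zero; suc)
open import Data.List using (List; []; _∷_; _++_; length)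
open import Data.List.Properties using (length-++)
open import Data.Vec using ([]; _∷_)
open import Data.Product using (_×_; _,_; proj₁; ∃)
open import Data.Maybe.Base using (Maybe; just; nothing)
open import Relation.Nullary using (yes; no; contradiction)
open import Relation.Binary.PropositionalEquality
  using (_≡_; _≢_; refl; sym; trans; cong; cong₂; subst; module ≡-Reasoning)
import Relation.Binary.Reasoning.Setoid as SetoidReasoning
open import Algebra.Bundles using (CommutativeRing)
import Algebra.Solver.Ring as RingSolver
open import Algebra.Solver.Ring.AlmostCommutativeRing
  using (fromCommutativeRing; _-Raw-AlmostCommutative⟶_)

-- The hypergeometric equation has coefficients in `t`, an infinite product, while the system for
-- `s` and `β` has coefficients in Lambert series. The bridge is an auxiliary series `y` = 27 `t`
-- `W`. Together with `a`² = `s` and `W` = `a`³ - `y` it gives `s`² = `a` `W` (1 + 27 `t`), and it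
-- turns the weight-4 term of the system into 27 `a` `t` `W`; then the hypergeometric equation
-- appears multiplied by `a` `W`. The obstacle is that `y` is classically 27 Σ χ₃(n/d) d² qⁿ, where
-- the character sits on the codivisor. This is not a series Σ α(d) G_d with α a quasi-polynomial,
-- so Liouville's method does not reach it directly. Hence `y` is defined from `a` and `β`, and its
-- properties are deduced algebraically from the other relations. Liouville's condition on g, T and
-- the resulting sums concerns functions that are polynomial on each residue class mod 3. So it
-- amounts to finitely many polynomial identities over ℚ, which are decided by comparing normal
-- forms.

module Q = +-*-Solver

-- The embedding of the natural numbers in ℚ

ℕtoℚ-toℚᵘ : ∀ n → toℚᵘ (ℕtoℚ n) ℚᵘ.≃ mkℚᵘ (ℤ.+ n) 0
ℕtoℚ-toℚᵘ n = ℚₚ.toℚᵘ-fromℚᵘ (mkℚᵘ (ℤ.+ n) 0)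

ℕtoℚ-+ : ∀ m n → ℕtoℚ (m ℕ.+ n) ≡ ℕtoℚ m + ℕtoℚ n
ℕtoℚ-+ m n = ℚₚ.toℚᵘ-injective (begin
  toℚᵘ (ℕtoℚ (m ℕ.+ n))              ≈⟨ ℕtoℚ-toℚᵘ (m ℕ.+ n) ⟩
  mkℚᵘ (ℤ.+ (m ℕ.+ n)) 0               ≈⟨ *≡* (cong (ℤ._* (ℤ.+ 1)) (cong₂ ℤ._+_ (sym (ℤₚ.*-identityʳ (ℤ.+ m))) (sym (ℤₚ.*-identityʳ (ℤ.+ n))))) ⟩
  mkℚᵘ (ℤ.+ m) 0 ℚᵘ.+ mkℚᵘ (ℤ.+ n) 0     ≈⟨ ℚᵘₚ.+-cong (ℕtoℚ-toℚᵘ m) (ℕtoℚ-toℚᵘ n) ⟨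
  toℚᵘ (ℕtoℚ m) ℚᵘ.+ toℚᵘ (ℕtoℚ n)   ≈⟨ ℚₚ.toℚᵘ-homo-+ (ℕtoℚ m) (ℕtoℚ n) ⟨
  toℚᵘ (ℕtoℚ m + ℕtoℚ n)             ∎)
  where open import Relation.Binary.Reasoning.Setoid ℚᵘₚ.≃-setoid

ℕtoℚ-suc : ∀ n → ℕtoℚ (suc n) ≡ 1ℚ + ℕtoℚ n
ℕtoℚ-suc n = ℕtoℚ-+ 1 n

ℕtoℚ-* : ∀ m n → ℕtoℚ (m ℕ.* n) ≡ ℕtoℚ m * ℕtoℚ n
ℕtoℚ-* zero    n = sym (*-zeroˡ (ℕtoℚ n))
ℕtoℚ-* (suc m) n = begin
  ℕtoℚ (n ℕ.+ m ℕ.* n)        ≡⟨ ℕtoℚ-+ n (m ℕ.* n) ⟩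
  ℕtoℚ n + ℕtoℚ (m ℕ.* n)     ≡⟨ cong (ℕtoℚ n +_) (ℕtoℚ-* m n) ⟩
  ℕtoℚ n + ℕtoℚ m * ℕtoℚ n    ≡⟨ Q.solve 2 (λ m n → n Q.:+ m Q.:* n Q.:= (Q.con 1ℚ Q.:+ m) Q.:* n) refl (ℕtoℚ m) (ℕtoℚ n) ⟩
  (1ℚ + ℕtoℚ m) * ℕtoℚ n      ≡⟨ cong (_* ℕtoℚ n) (ℕtoℚ-suc m) ⟨
  ℕtoℚ (suc m) * ℕtoℚ n       ∎
  where open ≡-Reasoning

/-*-cancel : ∀ a b → ((ℤ.+ a) / suc b) * ℕtoℚ (suc b) ≡ ℕtoℚ a
/-*-cancel a b = ℚₚ.toℚᵘ-injective (begin
  toℚᵘ (((ℤ.+ a) / suc b) * ℕtoℚ (suc b))              ≈⟨ ℚₚ.toℚᵘ-homo-* ((ℤ.+ a) / suc b) (ℕtoℚ (suc b)) ⟩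
  toℚᵘ ((ℤ.+ a) / suc b) ℚᵘ.* toℚᵘ (ℕtoℚ (suc b))      ≈⟨ ℚᵘₚ.*-cong (ℚₚ.toℚᵘ-fromℚᵘ (mkℚᵘ (ℤ.+ a) b)) (ℕtoℚ-toℚᵘ (suc b)) ⟩
  mkℚᵘ (ℤ.+ a) b ℚᵘ.* mkℚᵘ (ℤ.+ (suc b)) 0               ≈⟨ *≡* (trans (ℤₚ.*-identityʳ _) (cong (λ k → ℤ.+ a ℤ.* ℤ.+ suc k) (sym (ℕₚ.*-identityʳ b)))) ⟩
  mkℚᵘ (ℤ.+ a) 0                                       ≈⟨ ℕtoℚ-toℚᵘ a ⟨
  toℚᵘ (ℕtoℚ a)                                      ∎)
  where open import Relation.Binary.Reasoning.Setoid ℚᵘₚ.≃-setoid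

ℕtoℚ-suc-cancelˡ : ∀ n {p q} → ℕtoℚ (suc n) * p ≡ ℕtoℚ (suc n) * q → p ≡ q
ℕtoℚ-suc-cancelˡ n {p} {q} eq = begin
  p                            ≡⟨ inverse p ⟨
  i * (ℕtoℚ (suc n) * p)       ≡⟨ cong (i *_) eq ⟩
  i * (ℕtoℚ (suc n) * q)       ≡⟨ inverse q ⟩
  q                            ∎
  where
  open ≡-Reasoning
  i = (ℤ.+ 1) / suc n
  inverse : ∀ r → i * (ℕtoℚ (suc n) * r) ≡ r
  inverse r = trans (sym (*-assoc i _ r)) (trans (cong (_* r) (/-*-cancel 1 n)) (*-identityˡ r))

-- Finite sums

sumTo-cong : ∀ n {f g : ℕ → ℚ} → (∀ k → k ≤ n → f k ≡ g k) → sumTo n f ≡ sumTo n g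
sumTo-cong zero    eq = eq 0 z≤n
sumTo-cong (suc n) eq = cong₂ _+_ (sumTo-cong n (λ k k≤n → eq k (ℕₚ.m≤n⇒m≤1+n k≤n))) (eq (suc n) ℕₚ.≤-refl)

sumTo-zero : ∀ n {f : ℕ → ℚ} → (∀ k → k ≤ n → f k ≡ 0ℚ) → sumTo n f ≡ 0ℚ
sumTo-zero zero    eq = eq 0 z≤n
sumTo-zero (suc n) eq = cong₂ _+_ (sumTo-zero n (λ k k≤n → eq k (ℕₚ.m≤n⇒m≤1+n k≤n))) (eq (suc n) ℕₚ.≤-refl)

+-interchange : ∀ a b c d → (a + b) + (c + d) ≡ (a + c) + (b + d)
+-interchange = Q.solve 4 (λ a b c d → (a Q.:+ b) Q.:+ (c Q.:+ d) Q.:= (a Q.:+ c) Q.:+ (b Q.:+ d)) refl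

sumTo-+ : ∀ n (f g : ℕ → ℚ) → sumTo n (λ k → f k + g k) ≡ sumTo n f + sumTo n g
sumTo-+ zero    f g = refl
sumTo-+ (suc n) f g = trans (cong (_+ (f (suc n) + g (suc n))) (sumTo-+ n f g)) (+-interchange (sumTo n f) (sumTo n g) (f (suc n)) (g (suc n)))

sumTo-*ˡ : ∀ n c (f : ℕ → ℚ) → sumTo n (λ k → c * f k) ≡ c * sumTo n f
sumTo-*ˡ zero    c f = refl
sumTo-*ˡ (suc n) c f = trans (cong (_+ c * f (suc n)) (sumTo-*ˡ n c f)) (sym (*-distribˡ-+ c (sumTo n f) (f (suc n))))

sumTo-split : ∀ n (f : ℕ → ℚ) → sumTo (suc n) f ≡ f 0 + sumTo n (λ k → f (suc k))
sumTo-split zero    f = refl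
sumTo-split (suc n) f = trans (cong (_+ f (suc (suc n))) (sumTo-split n f)) (+-assoc (f 0) _ _)

sum1To-cong : ∀ n {f g : ℕ → ℚ} → (∀ k → k < n → f (suc k) ≡ g (suc k)) → sum1To n f ≡ sum1To n g
sum1To-cong zero    eq = refl
sum1To-cong (suc n) eq = cong₂ _+_ (sum1To-cong n (λ k k<n → eq k (ℕₚ.m≤n⇒m≤1+n k<n))) (eq n ℕₚ.≤-refl)

sum1To-zero : ∀ n {f : ℕ → ℚ} → (∀ k → k < n → f (suc k) ≡ 0ℚ) → sum1To n f ≡ 0ℚ
sum1To-zero zero    eq = refl
sum1To-zero (suc n) eq = cong₂ _+_ (sum1To-zero n (λ k k<n → eq k (ℕₚ.m≤n⇒m≤1+n k<n))) (eq n ℕₚ.≤-refl)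

sum1To-+ : ∀ n (f g : ℕ → ℚ) → sum1To n (λ k → f k + g k) ≡ sum1To n f + sum1To n g
sum1To-+ zero    f g = refl
sum1To-+ (suc n) f g = trans (cong (_+ (f (suc n) + g (suc n))) (sum1To-+ n f g)) (+-interchange (sum1To n f) (sum1To n g) (f (suc n)) (g (suc n)))

sum1To-*ˡ : ∀ n c (f : ℕ → ℚ) → sum1To n (λ k → c * f k) ≡ c * sum1To n f
sum1To-*ˡ zero    c f = sym (*-zeroʳ c)
sum1To-*ˡ (suc n) c f = trans (cong (_+ c * f (suc n)) (sum1To-*ˡ n c f)) (sym (*-distribˡ-+ c (sum1To n f) (f (suc n))))

sum1To-*ʳ : ∀ n c (f : ℕ → ℚ) → sum1To n (λ k → f k * c) ≡ sum1To n f * c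
sum1To-*ʳ zero    c f = sym (*-zeroˡ c)
sum1To-*ʳ (suc n) c f = trans (cong (_+ f (suc n) * c) (sum1To-*ʳ n c f)) (sym (*-distribʳ-+ c (sum1To n f) (f (suc n))))

sum1To-swap : ∀ m n (F : ℕ → ℕ → ℚ) →
  sum1To m (λ i → sum1To n (F i)) ≡ sum1To n (λ j → sum1To m (λ i → F i j))
sum1To-swap zero    n F = sym (sum1To-zero n (λ _ _ → refl))
sum1To-swap (suc m) n F =
  trans (cong (_+ sum1To n (F (suc m))) (sum1To-swap m n F))
        (sym (sum1To-+ n (λ j → sum1To m (λ i → F i j)) (F (suc m))))

sumTo-sum1To-swap : ∀ m n (F : ℕ → ℕ → ℚ) →
  sumTo m (λ i → sum1To n (F i)) ≡ sum1To n (λ j → sumTo m (λ i → F i j))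
sumTo-sum1To-swap zero    n F = refl
sumTo-sum1To-swap (suc m) n F =
  trans (cong (_+ sum1To n (F (suc m))) (sumTo-sum1To-swap m n F))
        (sym (sum1To-+ n (λ j → sumTo m (λ i → F i j)) (F (suc m))))

-- The ring of formal power series

infix 4 _≋_
-- A record, so that the type of a proof names the two series; a bare family of coefficient
-- equations would leave unification to guess them.
record _≋_ (f g : Series) : Set where
  constructor pointwise
  field at : ∀ n → f n ≡ g n
open _≋_ public

≋-refl : ∀ {f} → f ≋ f
≋-refl .at _ = refl

≋-sym : ∀ {f g} → f ≋ g → g ≋ f
≋-sym f≋g .at n = sym (f≋g .at n)

≋-trans : ∀ {f g h} → f ≋ g → g ≋ h → f ≋ h
≋-trans f≋g g≋h .at n = trans (f≋g .at n) (g≋h .at n)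

infixl 6 _⊕_
infixl 7 _⊗_
infix 8 ⊝_

_⊕_ : Series → Series → Series
(f ⊕ g) n = f n + g n

-- _⊛_ with a fixity.
_⊗_ : Series → Series → Series
f ⊗ g = f ⊛ g

⊝_ : Series → Series
(⊝ f) n = - f n

const : ℚ → Series
const c zero    = c
const c (suc _) = 0ℚ

⊛-cong-≤ : ∀ n {f f′ g g′ : Series} → (∀ k → k ≤ n → f k ≡ f′ k) → (∀ k → k ≤ n → g k ≡ g′ k) →
  (f ⊛ g) n ≡ (f′ ⊛ g′) n
⊛-cong-≤ n f≡ g≡ = sumTo-cong n (λ k k≤n → cong₂ _*_ (f≡ k k≤n) (g≡ (n ∸ k) (ℕₚ.m∸n≤m n k)))

⊛-cong : ∀ {f f′ g g′} → f ≋ f′ → g ≋ g′ → f ⊛ g ≋ f′ ⊛ g′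
⊛-cong f≋ g≋ .at n = ⊛-cong-≤ n (λ k _ → f≋ .at k) (λ k _ → g≋ .at k)

-- Peeling off the constant term of a factor gives an induction on the degree; commutativity,
-- associativity and the composition lemmas rest on it.
⊛-suc : ∀ f g n → (f ⊛ g) (suc n) ≡ f 0 * g (suc n) + (shiftDown f ⊛ g) n
⊛-suc f g n = sumTo-split n (λ k → f k * g (suc n ∸ k))

⊛-suc′ : ∀ f g n → (f ⊛ g) (suc n) ≡ (f ⊛ shiftDown g) n + f (suc n) * g 0
⊛-suc′ f g n = cong₂ _+_
  (sumTo-cong n (λ k k≤n → cong (λ m → f k * g m) (ℕₚ.+-∸-assoc 1 k≤n)))
  (cong (λ m → f (suc n) * g m) (ℕₚ.n∸n≡0 n))

⊛-comm′ : ∀ n f g → (f ⊛ g) n ≡ (g ⊛ f) n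
⊛-comm′ zero    f g = *-comm (f 0) (g 0)
⊛-comm′ (suc n) f g = begin
  (f ⊛ g) (suc n)                          ≡⟨ ⊛-suc f g n ⟩
  f 0 * g (suc n) + (shiftDown f ⊛ g) n    ≡⟨ cong₂ _+_ (*-comm (f 0) (g (suc n))) (⊛-comm′ n (shiftDown f) g) ⟩
  g (suc n) * f 0 + (g ⊛ shiftDown f) n    ≡⟨ +-comm (g (suc n) * f 0) ((g ⊛ shiftDown f) n) ⟩
  (g ⊛ shiftDown f) n + g (suc n) * f 0    ≡⟨ ⊛-suc′ g f n ⟨
  (g ⊛ f) (suc n)                          ∎
  where open ≡-Reasoning

⊛-distribˡ : ∀ f g h → f ⊛ (g ⊕ h) ≋ f ⊛ g ⊕ f ⊛ h
⊛-distribˡ f g h .at n = trans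
  (sumTo-cong n (λ k _ → *-distribˡ-+ (f k) (g (n ∸ k)) (h (n ∸ k))))
  (sumTo-+ n (λ k → f k * g (n ∸ k)) (λ k → f k * h (n ∸ k)))

⊛-comm : ∀ f g → f ⊛ g ≋ g ⊛ f
⊛-comm f g .at n = ⊛-comm′ n f g

⊛-distribʳ : ∀ f g h → (g ⊕ h) ⊛ f ≋ g ⊛ f ⊕ h ⊛ f
⊛-distribʳ f g h .at n = trans (⊛-comm′ n (g ⊕ h) f)
  (trans (⊛-distribˡ f g h .at n) (cong₂ _+_ (⊛-comm′ n f g) (⊛-comm′ n f h)))

*-⊛ : ∀ c f g n → ((λ k → c * f k) ⊛ g) n ≡ c * (f ⊛ g) n
*-⊛ c f g n = trans (sumTo-cong n (λ k _ → *-assoc c (f k) (g (n ∸ k)))) (sumTo-*ˡ n c (λ k → f k * g (n ∸ k)))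

⊛-assoc′ : ∀ n f g h → ((f ⊛ g) ⊛ h) n ≡ (f ⊛ (g ⊛ h)) n
⊛-assoc′ zero    f g h = *-assoc (f 0) (g 0) (h 0)
⊛-assoc′ (suc n) f g h = begin
  ((f ⊛ g) ⊛ h) (suc n)
    ≡⟨ ⊛-suc (f ⊛ g) h n ⟩
  f 0 * g 0 * h (suc n) + (shiftDown (f ⊛ g) ⊛ h) n
    ≡⟨ cong (f 0 * g 0 * h (suc n) +_) (⊛-cong {g = h} (pointwise (⊛-suc f g)) ≋-refl .at n) ⟩
  f 0 * g 0 * h (suc n) + (((λ k → f 0 * g (suc k)) ⊕ shiftDown f ⊛ g) ⊛ h) n
    ≡⟨ cong (f 0 * g 0 * h (suc n) +_) (⊛-distribʳ h (λ k → f 0 * g (suc k)) (shiftDown f ⊛ g) .at n) ⟩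
  f 0 * g 0 * h (suc n) + (((λ k → f 0 * g (suc k)) ⊛ h) n + ((shiftDown f ⊛ g) ⊛ h) n)
    ≡⟨ cong (f 0 * g 0 * h (suc n) +_) (cong₂ _+_ (*-⊛ (f 0) (shiftDown g) h n) (⊛-assoc′ n (shiftDown f) g h)) ⟩
  f 0 * g 0 * h (suc n) + (f 0 * (shiftDown g ⊛ h) n + (shiftDown f ⊛ (g ⊛ h)) n)
    ≡⟨ Q.solve 5 (λ a b c d e → a Q.:* b Q.:* c Q.:+ (a Q.:* d Q.:+ e) Q.:= a Q.:* (b Q.:* c Q.:+ d) Q.:+ e) refl
         (f 0) (g 0) (h (suc n)) _ _ ⟩
  f 0 * (g 0 * h (suc n) + (shiftDown g ⊛ h) n) + (shiftDown f ⊛ (g ⊛ h)) n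
    ≡⟨ cong (λ z → f 0 * z + (shiftDown f ⊛ (g ⊛ h)) n) (⊛-suc g h n) ⟨
  f 0 * (g ⊛ h) (suc n) + (shiftDown f ⊛ (g ⊛ h)) n
    ≡⟨ ⊛-suc f (g ⊛ h) n ⟨
  (f ⊛ (g ⊛ h)) (suc n) ∎
  where open ≡-Reasoning

⊛-assoc : ∀ f g h → (f ⊛ g) ⊛ h ≋ f ⊛ (g ⊛ h)
⊛-assoc f g h .at n = ⊛-assoc′ n f g h

const-cong : ∀ {c d} → c ≡ d → const c ≋ const d
const-cong refl = ≋-refl

const-0 : ∀ n → const 0ℚ n ≡ 0ℚ
const-0 zero    = refl
const-0 (suc _) = refl

const-⊛ : ∀ c f n → (const c ⊛ f) n ≡ c * f n
const-⊛ c f zero    = refl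
const-⊛ c f (suc n) = trans (⊛-suc (const c) f n)
  (trans (cong (c * f (suc n) +_) (sumTo-zero n (λ k _ → *-zeroˡ (f (n ∸ k))))) (+-identityʳ _))

oneS≋const : oneS ≋ const 1ℚ
oneS≋const .at zero    = refl
oneS≋const .at (suc _) = refl

⊛-identityˡ : ∀ f → oneS ⊛ f ≋ f
⊛-identityˡ f .at n = trans (⊛-cong oneS≋const (≋-refl {f}) .at n) (trans (const-⊛ 1ℚ f n) (*-identityˡ (f n)))

⊛-identityʳ : ∀ f → f ⊛ oneS ≋ f
⊛-identityʳ f = ≋-trans (⊛-comm f oneS) (⊛-identityˡ f)

series-commutativeRing : CommutativeRing _ _
series-commutativeRing = record
  { Carrier = Series ; _≈_ = _≋_ ; _+_ = _⊕_ ; _*_ = _⊗_ ; -_ = ⊝_ ; 0# = λ _ → 0ℚ ; 1# = oneS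
  ; isCommutativeRing = record
    { isRing = record
      { +-isAbelianGroup = record
        { isGroup = record
          { isMonoid = record
            { isSemigroup = record
              { isMagma = record
                { isEquivalence = record { refl = ≋-refl ; sym = ≋-sym ; trans = ≋-trans }
                ; ∙-cong = λ p q → pointwise (λ n → cong₂ _+_ (p .at n) (q .at n)) }
              ; assoc = λ f g h → pointwise (λ n → +-assoc (f n) (g n) (h n)) }
            ; identity = (λ f → pointwise (λ n → +-identityˡ (f n))) , (λ f → pointwise (λ n → +-identityʳ (f n))) }
          ; inverse = (λ f → pointwise (λ n → +-inverseˡ (f n))) , (λ f → pointwise (λ n → +-inverseʳ (f n)))
          ; ⁻¹-cong = λ p → pointwise (λ n → cong -_ (p .at n)) }
        ; comm = λ f g → pointwise (λ n → +-comm (f n) (g n)) }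
      ; *-cong = ⊛-cong
      ; *-assoc = ⊛-assoc
      ; *-identity = ⊛-identityˡ , ⊛-identityʳ
      ; distrib = ⊛-distribˡ , ⊛-distribʳ }
    ; *-comm = ⊛-comm } }

open CommutativeRing series-commutativeRing public
  using () renaming (setoid to ≋-setoid; +-cong to ⊕-cong; -‿cong to ⊝-cong)

private
  ℚ-rawRing = CommutativeRing.rawRing ℚₚ.+-*-commutativeRing
  series-acr = fromCommutativeRing series-commutativeRing

  const-morphism : ℚ-rawRing -Raw-AlmostCommutative⟶ series-acr
  const-morphism = record
    { ⟦_⟧ = const
    ; +-homo = λ _ _ → pointwise λ { zero → refl ; (suc _) → refl }
    ; *-homo = λ c d → pointwise λ { zero → refl ; (suc n) → sym (trans (const-⊛ c (const d) (suc n)) (*-zeroʳ c)) }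
    ; -‿homo = λ _ → pointwise λ { zero → refl ; (suc _) → refl }
    ; 0-homo = pointwise λ { zero → refl ; (suc _) → refl }
    ; 1-homo = ≋-sym oneS≋const }

  const-≟ : ∀ c d → Maybe (const c ≋ const d)
  const-≟ c d with c ℚₚ.≟ d
  ... | yes refl = just ≋-refl
  ... | no _     = nothing

-- Coefficients in ℚ, embedded by `const`, let the solver compute with rational constants. It sees
-- `oneS` as an atom, which is why `oneS` is traded for `const 1ℚ` or passed as a variable.
module S = RingSolver ℚ-rawRing series-acr const-morphism const-≟

module ≋-Reasoning = SetoidReasoning ≋-setoid

-- The derivation q d/dq

θ : Series → Series
θ f n = ℕtoℚ n * f n

θ-cong : ∀ {f g} → f ≋ g → θ f ≋ θ g
θ-cong f≋g .at n = cong (ℕtoℚ n *_) (f≋g .at n)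

θ-⊕ : ∀ f g → θ (f ⊕ g) ≋ θ f ⊕ θ g
θ-⊕ f g .at n = *-distribˡ-+ (ℕtoℚ n) (f n) (g n)

θ-const : ∀ c → θ (const c) ≋ const 0ℚ
θ-const c .at zero    = *-zeroˡ c
θ-const c .at (suc n) = *-zeroʳ (ℕtoℚ (suc n))

θ-oneS : θ oneS ≋ const 0ℚ
θ-oneS = ≋-trans (θ-cong oneS≋const) (θ-const 1ℚ)

θ-⊗ : ∀ f g → θ (f ⊗ g) ≋ θ f ⊗ g ⊕ f ⊗ θ g
θ-⊗ f g .at n = begin
  ℕtoℚ n * (f ⊛ g) n
    ≡⟨ sumTo-*ˡ n (ℕtoℚ n) (λ k → f k * g (n ∸ k)) ⟨
  sumTo n (λ k → ℕtoℚ n * (f k * g (n ∸ k)))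
    ≡⟨ sumTo-cong n (λ k k≤n → trans
         (cong (_* (f k * g (n ∸ k))) (trans (cong ℕtoℚ (sym (ℕₚ.m+[n∸m]≡n k≤n))) (ℕtoℚ-+ k (n ∸ k))))
         (Q.solve 4 (λ a b c d → (a Q.:+ b) Q.:* (c Q.:* d) Q.:= a Q.:* c Q.:* d Q.:+ c Q.:* (b Q.:* d)) refl
           (ℕtoℚ k) (ℕtoℚ (n ∸ k)) (f k) (g (n ∸ k)))) ⟩
  sumTo n (λ k → θ f k * g (n ∸ k) + f k * θ g (n ∸ k))
    ≡⟨ sumTo-+ n (λ k → θ f k * g (n ∸ k)) (λ k → f k * θ g (n ∸ k)) ⟩
  (θ f ⊛ g) n + (f ⊛ θ g) n ∎
  where open ≡-Reasoning

θ-const-⊗ : ∀ c f → θ (const c ⊗ f) ≋ const c ⊗ θ f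
θ-const-⊗ c f = ≋-trans (θ-⊗ (const c) f)
  (≋-trans (⊕-cong (⊛-cong (θ-const c) (≋-refl {f})) (≋-refl {const c ⊗ θ f}))
    (S.solve 2 (λ c f → S.con 0ℚ S.:* c S.:+ f S.:= f) ≋-refl f (const c ⊗ θ f)))

θ-⊝ : ∀ f → θ (⊝ f) ≋ ⊝ (θ f)
θ-⊝ f .at n = sym (ℚₚ.neg-distribʳ-* (ℕtoℚ n) (f n))

-- Logarithmic derivatives and first-order uniqueness

infix 4 _dlog_
-- Stated without a quotient, so that it also applies to series with zero constant term such as
-- `tS`.
record _dlog_ (f ℓ : Series) : Set where
  constructor by-dlog
  field θ-dlog : θ f ≋ ℓ ⊗ f
open _dlog_ public

dlog-congˡ : ∀ {f g ℓ} → f ≋ g → f dlog ℓ → g dlog ℓ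
dlog-congˡ {ℓ = ℓ} f≋g d = by-dlog (≋-trans (θ-cong (≋-sym f≋g)) (≋-trans (d .θ-dlog) (⊛-cong (≋-refl {ℓ}) f≋g)))

dlog-congʳ : ∀ {f ℓ ℓ′} → ℓ ≋ ℓ′ → f dlog ℓ → f dlog ℓ′
dlog-congʳ {f} ℓ≋ d = by-dlog (≋-trans (d .θ-dlog) (⊛-cong ℓ≋ (≋-refl {f})))

dlog-⊗ : ∀ {f g ℓ m} → f dlog ℓ → g dlog m → f ⊗ g dlog ℓ ⊕ m
dlog-⊗ {f} {g} {ℓ} {m} df dg = by-dlog (begin
  θ (f ⊗ g)                    ≈⟨ θ-⊗ f g ⟩
  θ f ⊗ g ⊕ f ⊗ θ g            ≈⟨ ⊕-cong (⊛-cong (df .θ-dlog) (≋-refl {g})) (⊛-cong (≋-refl {f}) (dg .θ-dlog)) ⟩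
  ℓ ⊗ f ⊗ g ⊕ f ⊗ (m ⊗ g)      ≈⟨ S.solve 4 (λ f g ℓ m → ℓ S.:* f S.:* g S.:+ f S.:* (m S.:* g) S.:= (ℓ S.:+ m) S.:* (f S.:* g)) ≋-refl f g ℓ m ⟩
  (ℓ ⊕ m) ⊗ (f ⊗ g)            ∎)
  where open ≋-Reasoning

const-suc : ∀ n → const (ℕtoℚ (suc n)) ≋ const 1ℚ ⊕ const (ℕtoℚ n)
const-suc n .at zero    = ℕtoℚ-suc n
const-suc n .at (suc _) = refl

dlog-powS : ∀ {f ℓ} e → f dlog ℓ → powS f e dlog const (ℕtoℚ e) ⊗ ℓ
dlog-powS {f} {ℓ} zero    df = by-dlog (≋-trans θ-oneS (S.solve 2 (λ ℓ o → S.con 0ℚ S.:= S.con 0ℚ S.:* ℓ S.:* o) ≋-refl ℓ oneS))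
dlog-powS {f} {ℓ} (suc e) df = dlog-congʳ {f ⊗ powS f e}
  (≋-trans (S.solve 2 (λ ℓ n → ℓ S.:+ n S.:* ℓ S.:= (S.con 1ℚ S.:+ n) S.:* ℓ) ≋-refl ℓ (const (ℕtoℚ e)))
           (⊛-cong (≋-sym (const-suc e)) (≋-refl {ℓ})))
  (dlog-⊗ {f} {powS f e} df (dlog-powS e df))

-- In degree n + 1 the equation reads (n+1) f(n+1) = Σ ℓ(k) f(n+1-k). As ℓ(0) = 0, only lower
-- coefficients of f contribute on the right, and these vanish by induction.
first-order-unique-0 : ∀ {f ℓ} → ℓ 0 ≡ 0ℚ → f dlog ℓ → f 0 ≡ 0ℚ → f ≋ const 0ℚ
first-order-unique-0 {f} {ℓ} ℓ₀ df f₀ .at = <-rec (λ n → f n ≡ const 0ℚ n) step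
  where
  step : ∀ n → (∀ {k} → k < n → f k ≡ const 0ℚ k) → f n ≡ const 0ℚ n
  step zero    ih = f₀
  step (suc n) ih = ℕtoℚ-suc-cancelˡ n (trans (df .θ-dlog .at (suc n)) (trans
    (sumTo-zero (suc n) λ { zero    _    → trans (cong (_* f (suc n)) ℓ₀) (*-zeroˡ (f (suc n)))
                          ; (suc k) k≤n  → trans (cong (ℓ (suc k) *_) (ih′ k)) (*-zeroʳ (ℓ (suc k))) })
    (sym (*-zeroʳ (ℕtoℚ (suc n))))))
    where
    ih′ : ∀ k → f (n ∸ k) ≡ 0ℚ
    ih′ k = trans (ih (s≤s (ℕₚ.m∸n≤m n k))) (const-0 (n ∸ k))

first-order-unique : ∀ {f g ℓ} → ℓ 0 ≡ 0ℚ → f dlog ℓ → g dlog ℓ → f 0 ≡ g 0 → f ≋ g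
first-order-unique {f} {g} {ℓ} ℓ₀ df dg eq₀ = ≋-trans
  (S.solve 2 (λ f g → f S.:= (f S.:- g) S.:+ g) ≋-refl f g)
  (≋-trans (⊕-cong (first-order-unique-0 {f ⊕ ⊝ g} {ℓ} ℓ₀ d-diff (trans (cong (_+ - g 0) eq₀) (+-inverseʳ (g 0)))) (≋-refl {g}))
    (S.solve 1 (λ g → S.con 0ℚ S.:+ g S.:= g) ≋-refl g))
  where
  d-diff : f ⊕ ⊝ g dlog ℓ
  d-diff = by-dlog (≋-trans (θ-⊕ f (⊝ g)) (≋-trans (⊕-cong (df .θ-dlog) (≋-trans (θ-⊝ g) (⊝-cong (dg .θ-dlog))))
    (S.solve 3 (λ f g ℓ → ℓ S.:* f S.:- ℓ S.:* g S.:= ℓ S.:* (f S.:- g)) ≋-refl f g ℓ)))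

shiftUp-cong : ∀ {f g} → f ≋ g → shiftUp f ≋ shiftUp g
shiftUp-cong f≋g .at zero    = refl
shiftUp-cong f≋g .at (suc n) = f≋g .at n

shiftUp-⊛ : ∀ f g → shiftUp f ⊛ g ≋ shiftUp (f ⊛ g)
shiftUp-⊛ f g .at zero    = *-zeroˡ (g 0)
shiftUp-⊛ f g .at (suc n) = trans (⊛-suc (shiftUp f) g n)
  (trans (cong (_+ (f ⊛ g) n) (*-zeroˡ (g (suc n)))) (+-identityˡ ((f ⊛ g) n)))

θ-shiftUp : ∀ f → θ (shiftUp f) ≋ shiftUp f ⊕ shiftUp (θ f)
θ-shiftUp f .at zero    = refl
θ-shiftUp f .at (suc n) = trans (cong (_* f n) (ℕtoℚ-suc n)) (trans (*-distribʳ-+ (f n) 1ℚ (ℕtoℚ n)) (cong (_+ ℕtoℚ n * f n) (*-identityˡ (f n))))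

dlog-shiftUp : ∀ {f ℓ} → f dlog ℓ → shiftUp f dlog oneS ⊕ ℓ
dlog-shiftUp {f} {ℓ} df = by-dlog (begin
  θ (shiftUp f)                   ≈⟨ θ-shiftUp f ⟩
  shiftUp f ⊕ shiftUp (θ f)       ≈⟨ ⊕-cong (≋-refl {shiftUp f}) (shiftUp-cong (≋-trans (df .θ-dlog) (⊛-comm ℓ f))) ⟩
  shiftUp f ⊕ shiftUp (f ⊗ ℓ)     ≈⟨ ⊕-cong (≋-sym (⊛-identityˡ (shiftUp f))) (≋-trans (≋-sym (shiftUp-⊛ f ℓ)) (⊛-comm (shiftUp f) ℓ)) ⟩
  oneS ⊗ shiftUp f ⊕ ℓ ⊗ shiftUp f ≈⟨ ⊛-distribʳ (shiftUp f) oneS ℓ ⟨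
  (oneS ⊕ ℓ) ⊗ shiftUp f          ∎)
  where open ≋-Reasoning

-- q^m and the geometric series

mono : ℕ → Series
mono zero    = oneS
mono (suc m) = shiftUp (mono m)

mono-⊛ : ∀ m n → mono m ⊛ mono n ≋ mono (m ℕ.+ n)
mono-⊛ zero    n = ⊛-identityˡ (mono n)
mono-⊛ (suc m) n = ≋-trans (shiftUp-⊛ (mono m) (mono n)) (shiftUp-cong (mono-⊛ m n))

mono-⊛-< : ∀ m f n → n < m → (mono m ⊛ f) n ≡ 0ℚ
mono-⊛-< (suc m) f zero    _         = *-zeroˡ (f 0)
mono-⊛-< (suc m) f (suc n) (s≤s n<m) = trans (shiftUp-⊛ (mono m) f .at (suc n)) (mono-⊛-< m f n n<m)

mono-⊛-+ : ∀ m f j → (mono m ⊛ f) (m ℕ.+ j) ≡ f j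
mono-⊛-+ zero    f j = ⊛-identityˡ f .at j
mono-⊛-+ (suc m) f j = trans (shiftUp-⊛ (mono m) f .at (suc (m ℕ.+ j))) (mono-⊛-+ m f j)

mono-diag : ∀ m → mono m m ≡ 1ℚ
mono-diag zero    = refl
mono-diag (suc m) = mono-diag m

mono-off : ∀ m n → n ≢ m → mono m n ≡ 0ℚ
mono-off zero    zero    n≢m = contradiction refl n≢m
mono-off zero    (suc n) n≢m = refl
mono-off (suc m) zero    n≢m = refl
mono-off (suc m) (suc n) n≢m = mono-off m n (λ n≡m → n≢m (cong suc n≡m))

θ-mono : ∀ m → θ (mono m) ≋ const (ℕtoℚ m) ⊗ mono m
θ-mono m .at n = trans (case n) (sym (const-⊛ (ℕtoℚ m) (mono m) n))
  where
  case : ∀ n → θ (mono m) n ≡ ℕtoℚ m * mono m n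
  case n with n ℕ.≟ m
  ... | yes refl = refl
  ... | no n≢m   = trans (cong (ℕtoℚ n *_) (mono-off m n n≢m)) (trans (*-zeroʳ (ℕtoℚ n))
                     (sym (trans (cong (ℕtoℚ m *_) (mono-off m n n≢m)) (*-zeroʳ (ℕtoℚ m)))))

oneMinusQ≋ : ∀ m → oneMinusQ (suc m) ≋ oneS ⊕ ⊝ mono (suc m)
oneMinusQ≋ m .at n with n ℕ.≟ 0 | n ℕ.≟ suc m
... | yes refl | _        = refl
... | no _     | yes refl = sym (trans (cong (λ z → 0ℚ + - z) (mono-diag m)) refl)
... | no n≢0   | no n≢m   with n
...   | zero   = contradiction refl n≢0
...   | suc n′ = sym (cong (λ z → 0ℚ + - z) (mono-off m n′ (λ eq → n≢m (cong suc eq))))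

geomQ-zero : ∀ m → geomQ m 0 ≡ 1ℚ
geomQ-zero m with m ∣? 0
... | yes _  = refl
... | no m∤0 = contradiction (m ∣0) m∤0

geomQ-< : ∀ m n → n < m → geomQ m n ≡ oneS n
geomQ-< m zero    _   = geomQ-zero m
geomQ-< m (suc n) n<m with m ∣? suc n
... | yes m∣n = contradiction (∣⇒≤ m∣n) (ℕₚ.<⇒≱ n<m)
... | no _    = refl

geomQ-+ : ∀ m j → geomQ m (m ℕ.+ j) ≡ geomQ m j
geomQ-+ m j with m ∣? (m ℕ.+ j) | m ∣? j
... | yes _ | yes _ = refl
... | no _  | no _  = refl
... | yes p | no ¬q = contradiction (∣m+n∣m⇒∣n p ∣-refl) ¬q
... | no ¬p | yes q = contradiction (∣m∣n⇒∣m+n ∣-refl q) ¬p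

geomQ-unfold : ∀ m → geomQ (suc m) ≋ oneS ⊕ mono (suc m) ⊗ geomQ (suc m)
geomQ-unfold m .at n with n ℕ.<? suc m
... | yes n<m = trans (geomQ-< (suc m) n n<m) (sym (trans (cong (oneS n +_) (mono-⊛-< (suc m) (geomQ (suc m)) n n<m)) (+-identityʳ (oneS n))))
... | no n≮m  = subst (λ n → geomQ (suc m) n ≡ (oneS ⊕ mono (suc m) ⊗ geomQ (suc m)) n) (ℕₚ.m+[n∸m]≡n (ℕₚ.≮⇒≥ n≮m))
  (trans (geomQ-+ (suc m) j) (sym (trans (cong (0ℚ +_) (mono-⊛-+ (suc m) (geomQ (suc m)) j)) (+-identityˡ (geomQ (suc m) j)))))
  where j = n ∸ suc m

-- q^m/(1-q^m)
G : ℕ → Series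
G m = geomQ m ⊕ ⊝ oneS

G-unfold : ∀ m → G (suc m) ≋ mono (suc m) ⊗ (oneS ⊕ G (suc m))
G-unfold m = begin
  v ⊕ ⊝ oneS                          ≈⟨ ⊕-cong (geomQ-unfold m) (≋-refl {⊝ oneS}) ⟩
  oneS ⊕ x ⊗ v ⊕ ⊝ oneS               ≈⟨ S.solve 3 (λ o x v → o S.:+ x S.:* v S.:- o S.:= x S.:* (o S.:+ (v S.:- o))) ≋-refl oneS x v ⟩
  x ⊗ (oneS ⊕ G (suc m))              ∎
  where
  open ≋-Reasoning
  x = mono (suc m)
  v = geomQ (suc m)

G-< : ∀ m n → n < m → G m n ≡ 0ℚ
G-< m n n<m = trans (cong (_+ - oneS n) (geomQ-< m n n<m)) (+-inverseʳ (oneS n))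

1#_ : ∀ {n} → S.Polynomial n → S.Polynomial n
1# p = S.con 1ℚ S.:+ p

oneS⊕≋ : ∀ f → oneS ⊕ f ≋ const 1ℚ ⊕ f
oneS⊕≋ f = ⊕-cong oneS≋const (≋-refl {f})

oneMinus-G : ∀ m → (const 1ℚ ⊕ ⊝ mono (suc m)) ⊗ (const 1ℚ ⊕ G (suc m)) ≋ const 1ℚ
oneMinus-G m = begin
  (const 1ℚ ⊕ ⊝ x) ⊗ (const 1ℚ ⊕ G′)                   ≈⟨ S.solve 2 (λ x g → (S.con 1ℚ S.:- x) S.:* (1# g) S.:= 1# g S.:- x S.:* (1# g)) ≋-refl x G′ ⟩
  const 1ℚ ⊕ G′ ⊕ ⊝ (x ⊗ (const 1ℚ ⊕ G′))              ≈⟨ ⊕-cong (≋-refl {const 1ℚ ⊕ G′}) (⊝-cong (≋-trans (⊛-cong (≋-refl {x}) (≋-sym (oneS⊕≋ G′))) (≋-sym (G-unfold m)))) ⟩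
  const 1ℚ ⊕ G′ ⊕ ⊝ G′                                 ≈⟨ S.solve 1 (λ g → 1# g S.:- g S.:= S.con 1ℚ) ≋-refl G′ ⟩
  const 1ℚ                                             ∎
  where
  open ≋-Reasoning
  x = mono (suc m)
  G′ = G (suc m)

-- With x = q^d and y = q^e, the identity 1 - xy = (1-x) + (1-y) - (1-x)(1-y) is multiplied by
-- 1/((1-x)(1-y)(1-xy)), and each 1/(1-x) is then written as 1 + x/(1-x).
G-⊗ : ∀ d e → let m = suc d ℕ.+ suc e in
  G (suc d) ⊗ G (suc e) ≋ G m ⊗ (const 1ℚ ⊕ G (suc d) ⊕ G (suc e))
G-⊗ d e = begin
  g ⊗ h
    ≈⟨ S.solve 2 (λ g h → g S.:* h S.:= S.con 1ℚ S.:* ((1# g) S.:* (1# h)) S.:- (1# g S.:+ h)) ≋-refl g h ⟩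
  const 1ℚ ⊗ (v ⊗ w) ⊕ ⊝ (v ⊕ h)
    ≈⟨ ⊕-cong (⊛-cong (≋-trans (≋-sym (oneMinus-G (d ℕ.+ suc e))) (⊛-cong (⊕-cong (≋-refl {const 1ℚ}) (⊝-cong (≋-sym (mono-⊛ (suc d) (suc e))))) (≋-refl {z}))) (≋-refl {v ⊗ w})) (≋-refl {⊝ (v ⊕ h)}) ⟩
  (const 1ℚ ⊕ ⊝ (x ⊗ y)) ⊗ z ⊗ (v ⊗ w) ⊕ ⊝ (v ⊕ h)
    ≈⟨ S.solve 5 (λ x y k g h → let v = 1# g ; w = 1# h ; z = 1# k ; u = (S.con 1ℚ S.:- x) S.:* v ; t = (S.con 1ℚ S.:- y) S.:* w in
         (S.con 1ℚ S.:- (x S.:* y)) S.:* z S.:* (v S.:* w) S.:- (v S.:+ h)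
           S.:= z S.:* (u S.:* w S.:+ t S.:* v S.:- u S.:* t) S.:- (v S.:+ h)) ≋-refl x y k g h ⟩
  z ⊗ (u ⊗ w ⊕ t ⊗ v ⊕ ⊝ (u ⊗ t)) ⊕ ⊝ (v ⊕ h)
    ≈⟨ ⊕-cong (⊛-cong (≋-refl {z}) (⊕-cong (⊕-cong (⊛-cong u≋1 (≋-refl {w})) (⊛-cong t≋1 (≋-refl {v}))) (⊝-cong (⊛-cong u≋1 t≋1)))) (≋-refl {⊝ (v ⊕ h)}) ⟩
  z ⊗ (const 1ℚ ⊗ w ⊕ const 1ℚ ⊗ v ⊕ ⊝ (const 1ℚ ⊗ const 1ℚ)) ⊕ ⊝ (v ⊕ h)
    ≈⟨ S.solve 3 (λ k g h → let v = 1# g ; w = 1# h ; o = S.con 1ℚ in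
         (1# k) S.:* (o S.:* w S.:+ o S.:* v S.:- o S.:* o) S.:- (v S.:+ h) S.:= k S.:* (1# g S.:+ h)) ≋-refl k g h ⟩
  k ⊗ (const 1ℚ ⊕ g ⊕ h) ∎
  where
  open ≋-Reasoning
  x = mono (suc d)
  y = mono (suc e)
  g = G (suc d)
  h = G (suc e)
  k = G (suc d ℕ.+ suc e)
  v = const 1ℚ ⊕ g
  w = const 1ℚ ⊕ h
  z = const 1ℚ ⊕ k
  u = (const 1ℚ ⊕ ⊝ x) ⊗ v
  t = (const 1ℚ ⊕ ⊝ y) ⊗ w
  u≋1 = oneMinus-G d
  t≋1 = oneMinus-G e

-- Differentiating G = x (1 + G) with x = q^m, m = `suc d`, gives (1-x) θG = m G; then multiply by
-- 1/(1-x) = 1 + G.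
θ-G : ∀ d → θ (G (suc d)) ≋ const (ℕtoℚ (suc d)) ⊗ (G (suc d) ⊗ G (suc d) ⊕ G (suc d))
θ-G d = begin
  g′
    ≈⟨ S.solve 1 (λ g → g S.:= S.con 1ℚ S.:* g) ≋-refl g′ ⟩
  const 1ℚ ⊗ g′
    ≈⟨ ⊛-cong (≋-sym (oneMinus-G d)) (≋-refl {g′}) ⟩
  (const 1ℚ ⊕ ⊝ x) ⊗ v ⊗ g′
    ≈⟨ S.solve 3 (λ x v g′ → (S.con 1ℚ S.:- x) S.:* v S.:* g′ S.:= v S.:* (g′ S.:- x S.:* g′)) ≋-refl x v g′ ⟩
  v ⊗ (g′ ⊕ ⊝ (x ⊗ g′))
    ≈⟨ ⊛-cong (≋-refl {v}) (⊕-cong unfold (≋-refl {⊝ (x ⊗ g′)})) ⟩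
  v ⊗ (n ⊗ g ⊕ x ⊗ g′ ⊕ ⊝ (x ⊗ g′))
    ≈⟨ S.solve 4 (λ n x g g′ → (S.con 1ℚ S.:+ g) S.:* (n S.:* g S.:+ x S.:* g′ S.:- x S.:* g′) S.:= n S.:* (g S.:* g S.:+ g)) ≋-refl n x g g′ ⟩
  n ⊗ (g ⊗ g ⊕ g) ∎
  where
  open ≋-Reasoning
  n = const (ℕtoℚ (suc d))
  x = mono (suc d)
  g = G (suc d)
  g′ = θ g
  v = const 1ℚ ⊕ g
  g-unfold : g ≋ x ⊗ v
  g-unfold = ≋-trans (G-unfold d) (⊛-cong (≋-refl {x}) (oneS⊕≋ g))
  unfold : g′ ≋ n ⊗ g ⊕ x ⊗ g′
  unfold = begin
    g′                               ≈⟨ θ-cong g-unfold ⟩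
    θ (x ⊗ v)                        ≈⟨ θ-⊗ x v ⟩
    θ x ⊗ v ⊕ x ⊗ θ v                ≈⟨ ⊕-cong (⊛-cong (θ-mono (suc d)) (≋-refl {v})) (⊛-cong (≋-refl {x}) (≋-trans (θ-⊕ (const 1ℚ) g) (⊕-cong (θ-const 1ℚ) (≋-refl {g′})))) ⟩
    n ⊗ x ⊗ v ⊕ x ⊗ (const 0ℚ ⊕ g′)  ≈⟨ S.solve 4 (λ n x v g′ → n S.:* x S.:* v S.:+ x S.:* (S.con 0ℚ S.:+ g′) S.:= n S.:* (x S.:* v) S.:+ x S.:* g′) ≋-refl n x v g′ ⟩
    n ⊗ (x ⊗ v) ⊕ x ⊗ g′             ≈⟨ ⊕-cong (⊛-cong (≋-refl {n}) (≋-sym g-unfold)) (≋-refl {x ⊗ g′}) ⟩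
    n ⊗ g ⊕ x ⊗ g′                   ∎

⊛-< : ∀ {f g} d e → (∀ k → k < d → f k ≡ 0ℚ) → (∀ k → k < e → g k ≡ 0ℚ) → ∀ n → n < d ℕ.+ e → (f ⊛ g) n ≡ 0ℚ
⊛-< {f} {g} d e f≡0 g≡0 n n<d+e = sumTo-zero n term
  where
  term : ∀ k → k ≤ n → f k * g (n ∸ k) ≡ 0ℚ
  term k k≤n with k ℕ.<? d
  ... | yes k<d = trans (cong (_* g (n ∸ k)) (f≡0 k k<d)) (*-zeroˡ (g (n ∸ k)))
  ... | no k≮d  = trans (cong (f k *_) (g≡0 (n ∸ k) (ℕₚ.+-cancelˡ-< k (n ∸ k) e
                    (subst (_< k ℕ.+ e) (sym (ℕₚ.m+[n∸m]≡n k≤n)) (ℕₚ.<-≤-trans n<d+e (ℕₚ.+-monoˡ-≤ e (ℕₚ.≮⇒≥ k≮d)))))))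
                    (*-zeroʳ (f k))

sum1To-trunc : ∀ {m n} {f : ℕ → ℚ} → m ≤ n → (∀ k → m < k → f k ≡ 0ℚ) → sum1To n f ≡ sum1To m f
sum1To-trunc {m} {zero}  z≤n f≡0 = refl
sum1To-trunc {m} {suc n} {f} m≤1+n f≡0 with m ℕ.≟ suc n
... | yes refl = refl
... | no m≢1+n = trans (cong₂ _+_ (sum1To-trunc {m} {n} {f} m≤n f≡0) (f≡0 (suc n) (s≤s m≤n))) (+-identityʳ (sum1To m f))
  where m≤n = ℕₚ.≤-pred (ℕₚ.≤∧≢⇒< m≤1+n m≢1+n)

-- Lambert series

-- The full series Σ α(d) q^d/(1-q^d): since `G d` begins in degree d, the terms with d > n do not
-- reach degree n.
L : (ℕ → ℚ) → Series
L α n = sum1To n (λ d → α d * G d n)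

L-extend : ∀ α {n m} → n ≤ m → L α n ≡ sum1To m (λ d → α d * G d n)
L-extend α {n} n≤m = sym (sum1To-trunc n≤m (λ d n<d → trans (cong (α d *_) (G-< d n n<d)) (*-zeroʳ (α d))))

L-cong : ∀ {α β} → (∀ d → α d ≡ β d) → L α ≋ L β
L-cong α≡β .at n = sum1To-cong n (λ d _ → cong (_* G (suc d) n) (α≡β (suc d)))

L-+ : ∀ α β → L (λ d → α d + β d) ≋ L α ⊕ L β
L-+ α β .at n = trans (sum1To-cong n (λ d _ → *-distribʳ-+ (G (suc d) n) (α (suc d)) (β (suc d)))) (sum1To-+ n (λ d → α d * G d n) (λ d → β d * G d n))

L-* : ∀ c α → L (λ d → c * α d) ≋ const c ⊗ L α
L-* c α .at n = trans (sum1To-cong n (λ d _ → *-assoc c (α (suc d)) (G (suc d) n)))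
  (trans (sum1To-*ˡ n c (λ d → α d * G d n)) (sym (const-⊛ c (L α) n)))

-- Sums over pairs and Liouville's method

sum² : ℕ → (ℕ → ℕ → ℚ) → ℚ
sum² n F = sum1To n (λ d → sum1To n (F d))

sum△ : ℕ → (ℕ → ℕ → ℚ) → ℚ
sum△ n F = sum1To n (λ m → sum1To (m ∸ 1) (λ d → F d m))

L-⊗ : ∀ α β n → (L α ⊗ L β) n ≡ sum² n (λ d e → α d * β e * (G d ⊗ G e) n)
L-⊗ α β n = begin
  sumTo n (λ k → L α k * L β (n ∸ k))
    ≡⟨ sumTo-cong n (λ k k≤n → cong₂ _*_ (L-extend α k≤n) (L-extend β (ℕₚ.m∸n≤m n k))) ⟩
  sumTo n (λ k → sum1To n (λ d → α d * G d k) * sum1To n (λ e → β e * G e (n ∸ k)))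
    ≡⟨ sumTo-cong n (λ k _ → trans (sym (sum1To-*ʳ n _ (λ d → α d * G d k)))
         (sum1To-cong n (λ d _ → sym (sum1To-*ˡ n (α (suc d) * G (suc d) k) (λ e → β e * G e (n ∸ k)))))) ⟩
  sumTo n (λ k → sum1To n (λ d → sum1To n (λ e → α d * G d k * (β e * G e (n ∸ k)))))
    ≡⟨ sumTo-sum1To-swap n n (λ k d → sum1To n (λ e → α d * G d k * (β e * G e (n ∸ k)))) ⟩
  sum1To n (λ d → sumTo n (λ k → sum1To n (λ e → α d * G d k * (β e * G e (n ∸ k)))))
    ≡⟨ sum1To-cong n (λ d _ → sumTo-sum1To-swap n n (λ k e → α (suc d) * G (suc d) k * (β e * G e (n ∸ k)))) ⟩
  sum² n (λ d e → sumTo n (λ k → α d * G d k * (β e * G e (n ∸ k))))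
    ≡⟨ sum1To-cong n (λ d _ → sum1To-cong n (λ e _ → trans
         (sumTo-cong n (λ k _ → Q.solve 4 (λ a x b y → a Q.:* x Q.:* (b Q.:* y) Q.:= a Q.:* b Q.:* (x Q.:* y)) refl
           (α (suc d)) (G (suc d) k) (β (suc e)) (G (suc e) (n ∸ k))))
         (sumTo-*ˡ n (α (suc d) * β (suc e)) (λ k → G (suc d) k * G (suc e) (n ∸ k))))) ⟩
  sum² n (λ d e → α d * β e * (G d ⊗ G e) n) ∎
  where open ≡-Reasoning

sum²-+ : ∀ n F H → sum² n (λ d e → F d e + H d e) ≡ sum² n F + sum² n H
sum²-+ n F H = trans (sum1To-cong n (λ d _ → sum1To-+ n (F (suc d)) (H (suc d)))) (sum1To-+ n (λ d → sum1To n (F d)) (λ d → sum1To n (H d)))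

sum²-cong : ∀ n {F H : ℕ → ℕ → ℚ} → (∀ d e → F (suc d) (suc e) ≡ H (suc d) (suc e)) → sum² n F ≡ sum² n H
sum²-cong n eq = sum1To-cong n (λ d _ → sum1To-cong n (λ e _ → eq d e))

sum²-dichotomy : ∀ n F → sum² n F ≡ sum△ n F + sum△ n (λ d e → F e d) + sum1To n (λ d → F d d)
sum²-dichotomy zero    F = refl
sum²-dichotomy (suc n) F = begin
  sum1To n (λ d → sum1To n (F d) + F d (suc n)) + (sum1To n (F (suc n)) + F (suc n) (suc n))
    ≡⟨ cong (_+ (r + q)) (sum1To-+ n (λ d → sum1To n (F d)) (λ d → F d (suc n))) ⟩
  sum² n F + c + (r + q)
    ≡⟨ cong (λ z → z + c + (r + q)) (sum²-dichotomy n F) ⟩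
  sum△ n F + sum△ n (λ d e → F e d) + sum1To n (λ d → F d d) + c + (r + q)
    ≡⟨ Q.solve 6 (λ a b d c r q → a Q.:+ b Q.:+ d Q.:+ c Q.:+ (r Q.:+ q) Q.:= a Q.:+ c Q.:+ (b Q.:+ r) Q.:+ (d Q.:+ q)) refl
         (sum△ n F) (sum△ n (λ d e → F e d)) (sum1To n (λ d → F d d)) c r q ⟩
  sum△ n F + c + (sum△ n (λ d e → F e d) + r) + (sum1To n (λ d → F d d) + q) ∎
  where
  open ≡-Reasoning
  c = sum1To n (λ d → F d (suc n))
  r = sum1To n (F (suc n))
  q = F (suc n) (suc n)

sum△-shear′ : ∀ n F → sum1To n (λ d → sum1To (n ∸ d) (λ e → F d (d ℕ.+ e))) ≡ sum△ n F
sum△-shear′ zero    F = refl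
sum△-shear′ (suc n) F = begin
  sum1To n (λ d → sum1To (suc n ∸ d) (λ e → F d (d ℕ.+ e))) + sum1To (n ∸ n) (λ e → F (suc n) (suc n ℕ.+ e))
    ≡⟨ cong₂ _+_
         (sum1To-cong n (λ k k<n → trans (cong (λ j → sum1To j (λ e → F (suc k) (suc k ℕ.+ e))) (ℕₚ.+-∸-assoc 1 k<n))
           (cong (λ j → sum1To (n ∸ suc k) (λ e → F (suc k) (suc k ℕ.+ e)) + F (suc k) j)
             (trans (ℕₚ.+-suc (suc k) (n ∸ suc k)) (cong suc (ℕₚ.m+[n∸m]≡n k<n))))))
         (cong (λ j → sum1To j (λ e → F (suc n) (suc n ℕ.+ e))) (ℕₚ.n∸n≡0 n)) ⟩
  sum1To n (λ d → sum1To (n ∸ d) (λ e → F d (d ℕ.+ e)) + F d (suc n)) + 0ℚ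
    ≡⟨ +-identityʳ _ ⟩
  sum1To n (λ d → sum1To (n ∸ d) (λ e → F d (d ℕ.+ e)) + F d (suc n))
    ≡⟨ sum1To-+ n (λ d → sum1To (n ∸ d) (λ e → F d (d ℕ.+ e))) (λ d → F d (suc n)) ⟩
  sum1To n (λ d → sum1To (n ∸ d) (λ e → F d (d ℕ.+ e))) + sum1To n (λ d → F d (suc n))
    ≡⟨ cong (_+ sum1To n (λ d → F d (suc n))) (sum△-shear′ n F) ⟩
  sum△ (suc n) F ∎
  where open ≡-Reasoning

-- The substitution m = d + e maps pairs of positive integers bijectively to pairs d < m. The
-- vanishing of `F` beyond n cuts the square d, e ≤ n down to the triangle d + e ≤ n.
sum△-shear : ∀ n F → (∀ d m → n < m → F d m ≡ 0ℚ) → sum² n (λ d e → F d (d ℕ.+ e)) ≡ sum△ n F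
sum△-shear n F F≡0 = trans
  (sum1To-cong n (λ d d<n → sum1To-trunc (ℕₚ.m∸n≤m n (suc d)) (λ e n-d<e → F≡0 (suc d) (suc d ℕ.+ e)
    (subst (_< suc d ℕ.+ e) (ℕₚ.m+[n∸m]≡n d<n) (ℕₚ.+-monoʳ-< (suc d) n-d<e)))))
  (sum△-shear′ n F)

sum△-cong : ∀ n {F H : ℕ → ℕ → ℚ} → (∀ d e → F (suc d) e ≡ H (suc d) e) → sum△ n F ≡ sum△ n H
sum△-cong n eq = sum1To-cong n (λ m _ → sum1To-cong m (λ d _ → eq d (suc m)))

-- Liouville's method: by G-⊗ the sum of g d (d + e) G_d G_e over all pairs is twice the sum of
-- g d m G_d G_m over d < m, up to a single Lambert series, and so is the sum of g d e G_d G_e.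
liouville : ∀ {α β h σ : ℕ → ℚ} (g : ℕ → ℕ → ℚ) →
  (∀ d e → g d e ≡ g e d) →
  (∀ d e → α d * β e + α e * β d ≡ g d e - g d (d ℕ.+ e)) →
  (∀ d → g d d ≡ ℕtoℚ d * h d) →
  (∀ m → sum1To m (λ d → g d m) ≡ σ m) →
  const ((ℤ.+ 2) / 1) ⊗ (L α ⊗ L β) ≋ θ (L h) ⊕ ⊝ L σ
liouville {α} {β} {h} {σ} g g-sym g-diff g-diag g-sum .at n = begin
  (const 2ℚ ⊗ (L α ⊗ L β)) n
    ≡⟨ const-⊛ 2ℚ (L α ⊗ L β) n ⟩
  2ℚ * (L α ⊗ L β) n
    ≡⟨ Q.solve 1 (λ x → Q.con 2ℚ Q.:* x Q.:= x Q.:+ x) refl ((L α ⊗ L β) n) ⟩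
  (L α ⊗ L β) n + (L α ⊗ L β) n
    -- Transposing the second copy of the product makes the weight symmetric: it becomes the left
    -- side of the kernel equation.
    ≡⟨ cong₂ _+_ (L-⊗ α β n) (trans (L-⊗ α β n) (sum1To-swap n n (λ d e → α d * β e * c d e))) ⟩
  sum² n (λ d e → α d * β e * c d e) + sum² n (λ d e → α e * β d * c e d)
    ≡⟨ sum²-+ n (λ d e → α d * β e * c d e) (λ d e → α e * β d * c e d) ⟨
  sum² n (λ d e → α d * β e * c d e + α e * β d * c e d)
    ≡⟨ sum²-cong n combine ⟩
  sum² n (λ d e → g d e * c d e + (K₁ d (d ℕ.+ e) + K₁ e (e ℕ.+ d) + K₂ d (d ℕ.+ e)))
    ≡⟨ trans (sum²-+ n (λ d e → g d e * c d e) (λ d e → K₁ d (d ℕ.+ e) + K₁ e (e ℕ.+ d) + K₂ d (d ℕ.+ e)))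
         (cong (sum² n (λ d e → g d e * c d e) +_) (trans (sum²-+ n (λ d e → K₁ d (d ℕ.+ e) + K₁ e (e ℕ.+ d)) (λ d e → K₂ d (d ℕ.+ e)))
           (cong (_+ sum² n (λ d e → K₂ d (d ℕ.+ e))) (sum²-+ n (λ d e → K₁ d (d ℕ.+ e)) (λ d e → K₁ e (e ℕ.+ d)))))) ⟩
  sum² n (λ d e → g d e * c d e) + (sum² n (λ d e → K₁ d (d ℕ.+ e)) + sum² n (λ d e → K₁ e (e ℕ.+ d)) + sum² n (λ d e → K₂ d (d ℕ.+ e)))
    ≡⟨ cong₂ _+_
         (trans (sum²-dichotomy n (λ d e → g d e * c d e)) (cong (λ z → T + z + D)
           (sum△-cong n (λ d e → cong₂ _*_ (g-sym e (suc d)) (⊛-comm (G e) (G (suc d)) .at n)))))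
         (cong₂ _+_ (cong₂ _+_ k₁ (trans (sum1To-swap n n (λ d e → K₁ e (e ℕ.+ d))) k₁)) (sum△-shear n K₂ K₂-zero)) ⟩
  T + T + D + (sum△ n K₁ + sum△ n K₁ + sum△ n K₂)
    ≡⟨ cong (λ z → T + T + D + (z + z + sum△ n K₂)) K₁-T ⟩
  T + T + D + (- 1ℚ * T + - 1ℚ * T + sum△ n K₂)
    -- The two off-diagonal halves of the sum of g d e G_d G_e cancel against the two sheared sums;
    -- the diagonal and a single Lambert series survive.
    ≡⟨ Q.solve 3 (λ t d k → t Q.:+ t Q.:+ d Q.:+ (Q.con (- 1ℚ) Q.:* t Q.:+ Q.con (- 1ℚ) Q.:* t Q.:+ k) Q.:= d Q.:+ k) refl T D (sum△ n K₂) ⟩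
  D + sum△ n K₂
    ≡⟨ sum1To-+ n (λ d → g d d * c d d) (λ m → sum1To (m ∸ 1) (λ d → K₂ d m)) ⟨
  sum1To n (λ m → g m m * c m m + sum1To (m ∸ 1) (λ d → K₂ d m))
    ≡⟨ sum1To-cong n (λ m _ → diagonal m) ⟩
  sum1To n (λ m → ℕtoℚ n * (h m * G m n) + - 1ℚ * (σ m * G m n))
    ≡⟨ sum1To-+ n (λ m → ℕtoℚ n * (h m * G m n)) (λ m → - 1ℚ * (σ m * G m n)) ⟩
  sum1To n (λ m → ℕtoℚ n * (h m * G m n)) + sum1To n (λ m → - 1ℚ * (σ m * G m n))
    ≡⟨ cong₂ _+_ (sum1To-*ˡ n (ℕtoℚ n) (λ m → h m * G m n)) (sum1To-*ˡ n (- 1ℚ) (λ m → σ m * G m n)) ⟩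
  ℕtoℚ n * L h n + - 1ℚ * L σ n
    ≡⟨ Q.solve 2 (λ a b → a Q.:+ Q.con (- 1ℚ) Q.:* b Q.:= a Q.:- b) refl (ℕtoℚ n * L h n) (L σ n) ⟩
  ℕtoℚ n * L h n - L σ n ∎
  where
  open ≡-Reasoning
  2ℚ = (ℤ.+ 2) / 1
  c K₁ K₂ : ℕ → ℕ → ℚ
  c d e = (G d ⊗ G e) n
  K₁ d m = - 1ℚ * (g d m * c d m)
  K₂ d m = - 1ℚ * (g d m * G m n)
  T = sum△ n (λ d e → g d e * c d e)
  D = sum1To n (λ d → g d d * c d d)

  c-split : ∀ d e → let m = suc d ℕ.+ suc e in c (suc d) (suc e) ≡ G m n + c (suc d) m + c (suc e) m
  c-split d e = trans (G-⊗ d e .at n) (S.solve 3 (λ k a b → k S.:* (S.con 1ℚ S.:+ a S.:+ b) S.:= k S.:+ a S.:* k S.:+ b S.:* k) ≋-refl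
    (G (suc d ℕ.+ suc e)) (G (suc d)) (G (suc e)) .at n)

  -- Both `g` and the left side of the kernel equation are symmetric in d and e, so the remaining
  -- term is symmetric too.
  g-shear : ∀ d e → g e (e ℕ.+ d) ≡ g d (d ℕ.+ e)
  g-shear d e = begin
    g e (e ℕ.+ d)                           ≡⟨ Q.solve 2 (λ x y → y Q.:= x Q.:- (x Q.:- y)) refl (g e d) (g e (e ℕ.+ d)) ⟩
    g e d - (g e d - g e (e ℕ.+ d))         ≡⟨ cong₂ _-_ (g-sym e d) (trans (sym (g-diff e d)) (trans (+-comm (α e * β d) (α d * β e)) (g-diff d e))) ⟩
    g d e - (g d e - g d (d ℕ.+ e))         ≡⟨ Q.solve 2 (λ x y → x Q.:- (x Q.:- y) Q.:= y) refl (g d e) (g d (d ℕ.+ e)) ⟩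
    g d (d ℕ.+ e)                           ∎

  combine : ∀ d e → α (suc d) * β (suc e) * c (suc d) (suc e) + α (suc e) * β (suc d) * c (suc e) (suc d) ≡
    g (suc d) (suc e) * c (suc d) (suc e) + (K₁ (suc d) (suc d ℕ.+ suc e) + K₁ (suc e) (suc e ℕ.+ suc d) + K₂ (suc d) (suc d ℕ.+ suc e))
  combine d′ e′ = begin
    α d * β e * c d e + α e * β d * c e d
      ≡⟨ cong (λ z → α d * β e * c d e + α e * β d * z) (⊛-comm (G e) (G d) .at n) ⟩
    α d * β e * c d e + α e * β d * c d e
      ≡⟨ *-distribʳ-+ (c d e) (α d * β e) (α e * β d) ⟨
    (α d * β e + α e * β d) * c d e
      ≡⟨ cong (_* c d e) (g-diff d e) ⟩
    (g d e - g d (d ℕ.+ e)) * c d e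
      ≡⟨ Q.solve 3 (λ x y z → (x Q.:- y) Q.:* z Q.:= x Q.:* z Q.:- y Q.:* z) refl (g d e) (g d (d ℕ.+ e)) (c d e) ⟩
    g d e * c d e - g d (d ℕ.+ e) * c d e
      ≡⟨ cong (λ z → g d e * c d e - g d (d ℕ.+ e) * z) (c-split d′ e′) ⟩
    g d e * c d e - g d (d ℕ.+ e) * (G (d ℕ.+ e) n + c d (d ℕ.+ e) + c e (d ℕ.+ e))
      ≡⟨ Q.solve 5 (λ w x k a b → w Q.:- x Q.:* (k Q.:+ a Q.:+ b) Q.:= w Q.:+ (Q.con (- 1ℚ) Q.:* (x Q.:* a) Q.:+ Q.con (- 1ℚ) Q.:* (x Q.:* b) Q.:+ Q.con (- 1ℚ) Q.:* (x Q.:* k))) refl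
           (g d e * c d e) (g d (d ℕ.+ e)) (G (d ℕ.+ e) n) (c d (d ℕ.+ e)) (c e (d ℕ.+ e)) ⟩
    g d e * c d e + (K₁ d (d ℕ.+ e) + - 1ℚ * (g d (d ℕ.+ e) * c e (d ℕ.+ e)) + K₂ d (d ℕ.+ e))
      ≡⟨ cong (λ z → g d e * c d e + (K₁ d (d ℕ.+ e) + - 1ℚ * z + K₂ d (d ℕ.+ e)))
           (cong₂ _*_ (sym (g-shear d e)) (cong (c e) (ℕₚ.+-comm d e))) ⟩
    g d e * c d e + (K₁ d (d ℕ.+ e) + K₁ e (e ℕ.+ d) + K₂ d (d ℕ.+ e)) ∎
    where
    d = suc d′
    e = suc e′

  K₁-zero : ∀ d m → n < m → K₁ d m ≡ 0ℚ
  K₁-zero d m n<m = trans (cong (λ z → - 1ℚ * (g d m * z))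
    (⊛-< {G d} {G m} 0 m (λ _ ()) (λ k → G-< m k) n n<m)) (Q.solve 1 (λ x → Q.con (- 1ℚ) Q.:* (x Q.:* Q.con 0ℚ) Q.:= Q.con 0ℚ) refl (g d m))

  K₂-zero : ∀ d m → n < m → K₂ d m ≡ 0ℚ
  K₂-zero d m n<m = trans (cong (λ z → - 1ℚ * (g d m * z)) (G-< m n n<m))
    (Q.solve 1 (λ x → Q.con (- 1ℚ) Q.:* (x Q.:* Q.con 0ℚ) Q.:= Q.con 0ℚ) refl (g d m))

  k₁ : sum² n (λ d e → K₁ d (d ℕ.+ e)) ≡ sum△ n K₁
  k₁ = sum△-shear n K₁ K₁-zero

  K₁-T : sum△ n K₁ ≡ - 1ℚ * T
  K₁-T = trans (sum1To-cong n (λ m _ → sum1To-*ˡ m (- 1ℚ) (λ d → g d (suc m) * c d (suc m))))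
    (sum1To-*ˡ n (- 1ℚ) (λ m → sum1To (m ∸ 1) (λ d → g d m * c d m)))

  θ-G′ : ∀ m → ℕtoℚ n * G (suc m) n ≡ ℕtoℚ (suc m) * (c (suc m) (suc m) + G (suc m) n)
  θ-G′ m = trans (θ-G m .at n) (const-⊛ (ℕtoℚ (suc m)) (G (suc m) ⊗ G (suc m) ⊕ G (suc m)) n)

  -- Since m (G_m² + G_m) = θ G_m, the diagonal term g m m G_m² becomes h m θ G_m minus g m m G_m,
  -- and the latter completes the sum of g d m from d < m to d ≤ m.
  diagonal : ∀ m → g (suc m) (suc m) * c (suc m) (suc m) + sum1To m (λ d → K₂ d (suc m)) ≡
    ℕtoℚ n * (h (suc m) * G (suc m) n) + - 1ℚ * (σ (suc m) * G (suc m) n)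
  diagonal m′ = begin
    g m m * c m m + sum1To m′ (λ d → K₂ d m)
      ≡⟨ cong (g m m * c m m +_) (trans (sum1To-*ˡ m′ (- 1ℚ) (λ d → g d m * G m n)) (cong (- 1ℚ *_) (sum1To-*ʳ m′ (G m n) (λ d → g d m)))) ⟩
    g m m * c m m + - 1ℚ * (s * G m n)
      ≡⟨ Q.solve 4 (λ x c s k → x Q.:* c Q.:+ Q.con (- 1ℚ) Q.:* (s Q.:* k) Q.:= x Q.:* (c Q.:+ k) Q.:+ Q.con (- 1ℚ) Q.:* ((s Q.:+ x) Q.:* k)) refl
           (g m m) (c m m) s (G m n) ⟩
    g m m * (c m m + G m n) + - 1ℚ * (sum1To m (λ d → g d m) * G m n)
      ≡⟨ cong₂ (λ x y → x * (c m m + G m n) + - 1ℚ * (y * G m n)) (g-diag m) (g-sum m) ⟩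
    ℕtoℚ m * h m * (c m m + G m n) + - 1ℚ * (σ m * G m n)
      ≡⟨ cong (_+ - 1ℚ * (σ m * G m n)) (Q.solve 3 (λ a h z → a Q.:* h Q.:* z Q.:= h Q.:* (a Q.:* z)) refl (ℕtoℚ m) (h m) (c m m + G m n)) ⟩
    h m * (ℕtoℚ m * (c m m + G m n)) + - 1ℚ * (σ m * G m n)
      ≡⟨ cong (λ z → h m * z + - 1ℚ * (σ m * G m n)) (θ-G′ m′) ⟨
    h m * (ℕtoℚ n * G m n) + - 1ℚ * (σ m * G m n)
      ≡⟨ cong (_+ - 1ℚ * (σ m * G m n)) (Q.solve 3 (λ h a z → h Q.:* (a Q.:* z) Q.:= a Q.:* (h Q.:* z)) refl (h m) (ℕtoℚ n) (G m n)) ⟩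
    ℕtoℚ n * (h m * G m n) + - 1ℚ * (σ m * G m n) ∎
    where
    m = suc m′
    s = sum1To m′ (λ d → g d m)

-- Quasi-polynomials of period 3

data Residue : Set where
  r₀ r₁ r₂ : Residue

next : Residue → Residue
next r₀ = r₁
next r₁ = r₂
next r₂ = r₀

infixl 6 _+ᵣ_
_+ᵣ_ : Residue → Residue → Residue
r₀ +ᵣ s = s
r₁ +ᵣ s = next s
r₂ +ᵣ s = next (next s)

residue : ℕ → Residue
residue zero    = r₀
residue (suc n) = next (residue n)

residue-+ : ∀ m n → residue (m ℕ.+ n) ≡ residue m +ᵣ residue n
residue-+ zero    n = refl
residue-+ (suc m) n = trans (cong next (residue-+ m n)) (next-+ (residue m) (residue n))
  where
  next-+ : ∀ r s → next (r +ᵣ s) ≡ next r +ᵣ s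
  next-+ r₀ s  = refl
  next-+ r₁ s  = refl
  next-+ r₂ r₀ = refl
  next-+ r₂ r₁ = refl
  next-+ r₂ r₂ = refl

χ : Residue → ℚ
χ r₀ = 0ℚ
χ r₁ = 1ℚ
χ r₂ = - 1ℚ

each : {P : Residue → Set} → P r₀ → P r₁ → P r₂ → ∀ r → P r
each p₀ p₁ p₂ r₀ = p₀
each p₀ p₁ p₂ r₁ = p₁
each p₀ p₁ p₂ r₂ = p₂

each² : {P : Residue → Residue → Set} → P r₀ r₀ → P r₀ r₁ → P r₀ r₂ → P r₁ r₀ → P r₁ r₁ → P r₁ r₂ →
  P r₂ r₀ → P r₂ r₁ → P r₂ r₂ → ∀ r s → P r s
each² p₀₀ p₀₁ p₀₂ p₁₀ p₁₁ p₁₂ p₂₀ p₂₁ p₂₂ = each (each p₀₀ p₀₁ p₀₂) (each p₁₀ p₁₁ p₁₂) (each p₂₀ p₂₁ p₂₂)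

-- Polynomial identities decided by normal forms

open Q using (Polynomial; op; con; var; _:^_; :-_; _:+_; _:*_; _:-_)

-- Separating the comparison of normal forms from evaluation makes the comparison a closed
-- computation: for concrete polynomials it holds by `refl`, whatever the environment.
normalise-sound : ∀ {n} (p q : Polynomial n) → Q.normalise p ≡ Q.normalise q → ∀ ρ → Q.⟦ p ⟧ ρ ≡ Q.⟦ q ⟧ ρ
normalise-sound p q eq ρ = Q.prove ρ p q (cong (λ N → Q.⟦ N ⟧N ρ) eq)

infixl 9 _[_]
_[_] : ∀ {n} → Polynomial 1 → Polynomial n → Polynomial n
op o p q [ s ] = op o (p [ s ]) (q [ s ])
con c    [ s ] = con c
var zero [ s ] = s
(p :^ n) [ s ] = (p [ s ]) :^ n
(:- p)   [ s ] = :- (p [ s ])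

[]-sound : ∀ {n} p (s : Polynomial n) ρ → Q.⟦ p [ s ] ⟧ ρ ≡ Q.⟦ p ⟧ (Q.⟦ s ⟧ ρ ∷ [])
[]-sound (op o p q) s ρ = cong₂ (Q.sem o) ([]-sound p s ρ) ([]-sound q s ρ)
[]-sound (con c)    s ρ = refl
[]-sound (var zero) s ρ = refl
-- The polynomial `con x :^ n` stands for the n-th power of x as the solver interprets it, so that
-- congruence acts on the base.
[]-sound (p :^ n)   s ρ = cong (λ x → Q.⟦ con x :^ n ⟧ ρ) ([]-sound p s ρ)
[]-sound (:- p)     s ρ = cong -_ ([]-sound p s ρ)

QuasiPoly : Set
QuasiPoly = Residue → Polynomial 1

⟪_⟫ : QuasiPoly → ℕ → ℚ
⟪ p ⟫ n = Q.⟦ p (residue n) ⟧ (ℕtoℚ n ∷ [])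

⟪⟫-[] : ∀ p n {m} (s : Polynomial m) ρ → Q.⟦ s ⟧ ρ ≡ ℕtoℚ n → Q.⟦ p (residue n) [ s ] ⟧ ρ ≡ ⟪ p ⟫ n
⟪⟫-[] p n s ρ eq = trans ([]-sound (p (residue n)) s ρ) (cong (λ x → Q.⟦ p (residue n) ⟧ (x ∷ [])) eq)

infixl 6 _+ₚ_ _-ₚ_
infixl 7 _*ₚ_ _·_ _··_
_+ₚ_ _-ₚ_ _*ₚ_ : QuasiPoly → QuasiPoly → QuasiPoly
(p +ₚ q) r = p r :+ q r
(p -ₚ q) r = p r :- q r
(p *ₚ q) r = p r :* q r

_·_ : ℚ → QuasiPoly → QuasiPoly
(c · p) r = con c :* p r

_··_ : ℕ → QuasiPoly → QuasiPoly
n ·· p = ℕtoℚ n · p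

0ₚ 1ₚ 𝕩 𝕕 : QuasiPoly
0ₚ r = con 0ℚ
1ₚ r = con 1ℚ
𝕩  r = con (χ r)
𝕕  r = var zero

frac : ℕ → (n : ℕ) → .{{_ : ℕ.NonZero n}} → ℚ
frac a b = (ℤ.+ a) / b

-- A quasi-polynomial with its discrete antiderivative. The two proof fields are the base and the
-- step of an induction, stated for normal forms, so that a proposed closed form is certified by
-- `refl` for each residue.
record Summand : Set where
  field
    term partial : QuasiPoly
    base : Q.normalise (partial r₀ [ con {1} 0ℚ ]) ≡ Q.normalise (con 0ℚ)
    step : ∀ r → Q.normalise (partial (next r) [ con 1ℚ :+ var zero ]) ≡
                 Q.normalise (partial r :+ term (next r) [ con 1ℚ :+ var zero ])

module _ (s : Summand) where
  open Summand s

  sum-term : ∀ n → sum1To n ⟪ term ⟫ ≡ ⟪ partial ⟫ n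
  sum-term zero    = sym (trans (sym (⟪⟫-[] partial 0 (con 0ℚ) (0ℚ ∷ []) refl))
                       (normalise-sound (partial r₀ [ con 0ℚ ]) (con 0ℚ) base (0ℚ ∷ [])))
  sum-term (suc n) = begin
    sum1To n ⟪ term ⟫ + ⟪ term ⟫ (suc n)           ≡⟨ cong₂ _+_ (sum-term n) (sym (shift term)) ⟩
    Q.⟦ partial r :+ term (next r) [ 1+d ] ⟧ ρ     ≡⟨ normalise-sound (partial (next r) [ 1+d ]) (partial r :+ term (next r) [ 1+d ]) (step r) ρ ⟨
    Q.⟦ partial (next r) [ 1+d ] ⟧ ρ               ≡⟨ shift partial ⟩
    ⟪ partial ⟫ (suc n)                            ∎
    where
    open ≡-Reasoning
    r = residue n
    ρ = ℕtoℚ n ∷ []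
    1+d : Polynomial 1
    1+d = con 1ℚ :+ var zero
    shift : ∀ p → Q.⟦ p (next r) [ 1+d ] ⟧ ρ ≡ ⟪ p ⟫ (suc n)
    shift p = ⟪⟫-[] p (suc n) 1+d ρ (sym (ℕtoℚ-suc n))

infixr 5 _⊠_∷_
-- A kernel g(m,n) as a sum of products with separated variables. The factor in m carries its
-- partial sums, so that the sum of g(m,n) over m ≤ n, which Liouville's method requires, is again
-- an explicit quasi-polynomial in n.
data BiQuasi : Set where
  []    : BiQuasi
  _⊠_∷_ : Summand → QuasiPoly → BiQuasi → BiQuasi

open Summand using (term; partial)

biValue : BiQuasi → ℕ → ℕ → ℚ
biValue []          m n = 0ℚ
biValue (s ⊠ q ∷ g) m n = ⟪ term s ⟫ m * ⟪ q ⟫ n + biValue g m n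

biPoly : ∀ {k} → BiQuasi → Residue → Residue → Polynomial k → Polynomial k → Polynomial k
biPoly []          r r′ u v = con 0ℚ
biPoly (s ⊠ q ∷ g) r r′ u v = term s r [ u ] :* q r′ [ v ] :+ biPoly g r r′ u v

biPoly-sound : ∀ g {k} m n (u v : Polynomial k) ρ → Q.⟦ u ⟧ ρ ≡ ℕtoℚ m → Q.⟦ v ⟧ ρ ≡ ℕtoℚ n →
  Q.⟦ biPoly g (residue m) (residue n) u v ⟧ ρ ≡ biValue g m n
biPoly-sound []          m n u v ρ eq eq′ = refl
biPoly-sound (s ⊠ q ∷ g) m n u v ρ eq eq′ = cong₂ _+_
  (cong₂ _*_ (⟪⟫-[] (term s) m u ρ eq) (⟪⟫-[] q n v ρ eq′)) (biPoly-sound g m n u v ρ eq eq′)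

biSum : BiQuasi → QuasiPoly
biSum []          = 0ₚ
biSum (s ⊠ q ∷ g) = partial s *ₚ q +ₚ biSum g

biSum-sound : ∀ g n → sum1To n (λ m → biValue g m n) ≡ ⟪ biSum g ⟫ n
biSum-sound []          n = sum1To-zero n (λ _ _ → refl)
biSum-sound (s ⊠ q ∷ g) n = trans (sum1To-+ n (λ m → ⟪ term s ⟫ m * ⟪ q ⟫ n) (λ m → biValue g m n))
  (cong₂ _+_ (trans (sum1To-*ʳ n (⟪ q ⟫ n) ⟪ term s ⟫) (cong (_* ⟪ q ⟫ n) (sum-term s n))) (biSum-sound g n))

-- Combinations are kept as data, so that all Liouville identities come out as relations between the
-- same few series `L ⟪ p ⟫`.
Linear : Set
Linear = List (ℚ × QuasiPoly)

combine : Linear → QuasiPoly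
combine []            = 0ₚ
combine ((c , p) ∷ l) = c · p +ₚ combine l

lambert θ-lambert : Linear → Series
lambert []              = const 0ℚ
lambert ((c , p) ∷ l)   = const c ⊗ L ⟪ p ⟫ ⊕ lambert l
θ-lambert []            = const 0ℚ
θ-lambert ((c , p) ∷ l) = const c ⊗ θ (L ⟪ p ⟫) ⊕ θ-lambert l

L-combine : ∀ l → L ⟪ combine l ⟫ ≋ lambert l
L-combine []            .at zero    = refl
L-combine []            .at (suc n) = sum1To-zero (suc n) (λ d _ → *-zeroˡ (G (suc d) (suc n)))
L-combine ((c , p) ∷ l) = ≋-trans (L-+ ⟪ c · p ⟫ ⟪ combine l ⟫) (⊕-cong (L-* c ⟪ p ⟫) (L-combine l))

θ-L-combine : ∀ l → θ (L ⟪ combine l ⟫) ≋ θ-lambert l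
θ-L-combine l = ≋-trans (θ-cong (L-combine l)) (expand l)
  where
  expand : ∀ l → θ (lambert l) ≋ θ-lambert l
  expand []            = θ-const 0ℚ
  expand ((c , p) ∷ l) = ≋-trans (θ-⊕ (const c ⊗ L ⟪ p ⟫) (lambert l)) (⊕-cong (θ-const-⊗ c (L ⟪ p ⟫)) (expand l))

module _ (α′ β′ h′ σ′ : Linear) (g : BiQuasi) where
  private
    α β h σ : QuasiPoly
    α = combine α′
    β = combine β′
    h = combine h′
    σ = combine σ′

    D E : Polynomial 2
    D = var zero
    E = var (suc zero)

    lhs rhs : Residue → Residue → Polynomial 2
    lhs r s = α r [ D ] :* β s [ E ] :+ α s [ E ] :* β r [ D ]
    rhs r s = biPoly g r s D E :- biPoly g r (r +ᵣ s) D (D :+ E)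

  -- Each hypothesis of `liouville` becomes one polynomial identity for every residue, or pair of
  -- residues, mod 3; shifting the second argument to d + e adds the residues.
  quasi-liouville :
    (∀ r s → Q.normalise (biPoly g r s D E) ≡ Q.normalise (biPoly g s r E D)) →
    (∀ r s → Q.normalise (lhs r s) ≡ Q.normalise (rhs r s)) →
    (∀ r → Q.normalise (biPoly {1} g r r (var zero) (var zero)) ≡ Q.normalise (var zero :* h r)) →
    (∀ r → Q.normalise (biSum g r) ≡ Q.normalise (σ r)) →
    const (frac 2 1) ⊗ (lambert α′ ⊗ lambert β′) ≋ θ-lambert h′ ⊕ ⊝ lambert σ′
  quasi-liouville sym-check diff-check diag-check sum-check =
    ≋-trans (⊛-cong (≋-refl {const (frac 2 1)}) (⊛-cong (≋-sym (L-combine α′)) (≋-sym (L-combine β′)))) (≋-trans relation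
      (⊕-cong (θ-L-combine h′) (⊝-cong (L-combine σ′))))
    where
    open ≡-Reasoning
    value : ∀ m n → Q.⟦ biPoly g (residue m) (residue n) D E ⟧ (ℕtoℚ m ∷ ℕtoℚ n ∷ []) ≡ biValue g m n
    value m n = biPoly-sound g m n D E (ℕtoℚ m ∷ ℕtoℚ n ∷ []) refl refl

    relation : const (frac 2 1) ⊗ (L ⟪ α ⟫ ⊗ L ⟪ β ⟫) ≋ θ (L ⟪ h ⟫) ⊕ ⊝ L ⟪ σ ⟫
    relation = liouville {⟪ α ⟫} {⟪ β ⟫} {⟪ h ⟫} {⟪ σ ⟫} (biValue g)
      (λ m n → trans (sym (value m n)) (trans (normalise-sound (biPoly g (residue m) (residue n) D E) (biPoly g (residue n) (residue m) E D)
        (sym-check (residue m) (residue n)) (ℕtoℚ m ∷ ℕtoℚ n ∷ [])) (biPoly-sound g n m E D (ℕtoℚ m ∷ ℕtoℚ n ∷ []) refl refl)))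
      (λ m n → let ρ = ℕtoℚ m ∷ ℕtoℚ n ∷ [] in begin
        ⟪ α ⟫ m * ⟪ β ⟫ n + ⟪ α ⟫ n * ⟪ β ⟫ m
          ≡⟨ cong₂ _+_ (cong₂ _*_ (⟪⟫-[] α m D ρ refl) (⟪⟫-[] β n E ρ refl)) (cong₂ _*_ (⟪⟫-[] α n E ρ refl) (⟪⟫-[] β m D ρ refl)) ⟨
        Q.⟦ lhs (residue m) (residue n) ⟧ ρ
          ≡⟨ normalise-sound (lhs (residue m) (residue n)) (rhs (residue m) (residue n)) (diff-check (residue m) (residue n)) ρ ⟩
        Q.⟦ biPoly g (residue m) (residue n) D E ⟧ ρ - Q.⟦ biPoly g (residue m) (residue m +ᵣ residue n) D (D :+ E) ⟧ ρ
          ≡⟨ cong₂ _-_ (value m n) (trans (cong (λ r → Q.⟦ biPoly g (residue m) r D (D :+ E) ⟧ ρ) (sym (residue-+ m n)))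
               (biPoly-sound g m (m ℕ.+ n) D (D :+ E) ρ refl (sym (ℕtoℚ-+ m n)))) ⟩
        biValue g m n - biValue g m (m ℕ.+ n) ∎)
      (λ m → trans (sym (biPoly-sound g m m (var zero) (var zero) (ℕtoℚ m ∷ []) refl refl))
        (normalise-sound (biPoly g (residue m) (residue m) (var zero) (var zero)) (var zero :* h (residue m)) (diag-check (residue m)) (ℕtoℚ m ∷ [])))
      (λ m → trans (biSum-sound g m) (normalise-sound (biSum g (residue m)) (σ (residue m)) (sum-check (residue m)) (ℕtoℚ m ∷ [])))

-- Eta products

powS-cong-≤ : ∀ e {f g : Series} n → (∀ k → k ≤ n → f k ≡ g k) → powS f e n ≡ powS g e n
powS-cong-≤ zero    n eq = refl
powS-cong-≤ (suc e) n eq = ⊛-cong-≤ n eq (λ k k≤n → powS-cong-≤ e k (λ j j≤k → eq j (ℕₚ.≤-trans j≤k k≤n)))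

powS-oneS : ∀ e → powS oneS e ≋ oneS
powS-oneS zero    = ≋-refl
powS-oneS (suc e) = ≋-trans (⊛-identityˡ (powS oneS e)) (powS-oneS e)

powS-≡oneS : ∀ e {f : Series} {m} → (∀ k → k < m → f k ≡ oneS k) → ∀ k → k < m → powS f e k ≡ oneS k
powS-≡oneS e eq k k<m = trans (powS-cong-≤ e k (λ j j≤k → eq j (ℕₚ.≤-<-trans j≤k k<m))) (powS-oneS e .at k)

module _ {F ℓ : ℕ → Series}
  (dlog-F : ∀ k → F (suc k) dlog ℓ (suc k))
  (F-< : ∀ k j → j < suc k → F (suc k) j ≡ oneS j)
  (ℓ-< : ∀ k j → j < k → ℓ k j ≡ 0ℚ)
  where

  dlog-prodTo : ∀ n → prodTo n F dlog (λ j → sum1To n (λ k → ℓ k j))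
  dlog-prodTo zero    = dlog-congʳ {oneS} {const 0ℚ} {λ _ → 0ℚ} (pointwise λ { zero → refl ; (suc _) → refl })
    (by-dlog (≋-trans θ-oneS (S.solve 1 (λ o → S.con 0ℚ S.:= S.con 0ℚ S.:* o) ≋-refl oneS)))
  dlog-prodTo (suc n) = dlog-⊗ {prodTo n F} {F (suc n)} (dlog-prodTo n) (dlog-F n)

  prodTo-stable : ∀ {m n} → m ≤ n → prodTo n F m ≡ prodInf F m
  prodTo-stable {m} {zero}  z≤n = refl
  prodTo-stable {m} {suc n} m≤1+n with m ℕ.≟ suc n
  ... | yes refl = refl
  ... | no m≢1+n = trans (⊛-cong-≤ m {prodTo n F} {prodTo n F} {F (suc n)} {oneS} (λ _ _ → refl) (λ k k≤m → F-< n k (s≤s (ℕₚ.≤-trans k≤m m≤n))))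
                     (trans (⊛-identityʳ (prodTo n F) .at m) (prodTo-stable m≤n))
    where m≤n = ℕₚ.≤-pred (ℕₚ.≤∧≢⇒< m≤1+n m≢1+n)

  -- Up to degree n the product agrees with its first n factors, and the sum of logarithmic
  -- derivatives with its first n terms, so the finite case suffices in each degree.
  dlog-prodInf : prodInf F dlog (λ j → sum1To j (λ k → ℓ k j))
  dlog-prodInf = by-dlog (pointwise λ n → trans (dlog-prodTo n .θ-dlog .at n)
    (⊛-cong-≤ n {λ j → sum1To n (λ k → ℓ k j)} {λ j → sum1To j (λ k → ℓ k j)} {prodTo n F} {prodInf F}
      (λ j j≤n → sum1To-trunc j≤n (λ k j<k → ℓ-< k j j<k))
      (λ j j≤n → prodTo-stable j≤n)))

oneMinusQ-< : ∀ m j → j < m → oneMinusQ m j ≡ oneS j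
oneMinusQ-< (suc m) j j<m = trans (oneMinusQ≋ m .at j)
  (trans (cong (λ z → oneS j + - z) (mono-off (suc m) j (ℕₚ.<⇒≢ j<m))) (+-identityʳ (oneS j)))

dlog-oneMinusQ : ∀ m → oneMinusQ (suc m) dlog const (- ℕtoℚ (suc m)) ⊗ G (suc m)
dlog-oneMinusQ m = dlog-congˡ (≋-sym u-def) (by-dlog (begin
  θ (const 1ℚ ⊕ ⊝ x)               ≈⟨ ≋-trans (θ-⊕ (const 1ℚ) (⊝ x)) (⊕-cong (θ-const 1ℚ) (≋-trans (θ-⊝ x) (⊝-cong (θ-mono (suc m))))) ⟩
  const 0ℚ ⊕ ⊝ (n ⊗ x)             ≈⟨ S.solve 2 (λ n x → S.con 0ℚ S.:- n S.:* x S.:= (S.:- n) S.:* (x S.:* S.con 1ℚ)) ≋-refl n x ⟩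
  ⊝ n ⊗ (x ⊗ const 1ℚ)             ≈⟨ ⊛-cong (neg-const (ℕtoℚ (suc m))) (⊛-cong (≋-refl {x}) (≋-sym (oneMinus-G m))) ⟩
  n′ ⊗ (x ⊗ ((const 1ℚ ⊕ ⊝ x) ⊗ (const 1ℚ ⊕ G (suc m))))
    ≈⟨ S.solve 3 (λ n x g → n S.:* (x S.:* ((S.con 1ℚ S.:- x) S.:* (S.con 1ℚ S.:+ g))) S.:= n S.:* (x S.:* (S.con 1ℚ S.:+ g)) S.:* (S.con 1ℚ S.:- x)) ≋-refl n′ x (G (suc m)) ⟩
  n′ ⊗ (x ⊗ (const 1ℚ ⊕ G (suc m))) ⊗ (const 1ℚ ⊕ ⊝ x)
    ≈⟨ ⊛-cong (⊛-cong (≋-refl {n′}) (≋-sym (≋-trans (G-unfold m) (⊛-cong (≋-refl {x}) (oneS⊕≋ (G (suc m))))))) (≋-refl {const 1ℚ ⊕ ⊝ x}) ⟩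
  n′ ⊗ G (suc m) ⊗ (const 1ℚ ⊕ ⊝ x) ∎))
  where
  open ≋-Reasoning
  x = mono (suc m)
  n = const (ℕtoℚ (suc m))
  n′ = const (- ℕtoℚ (suc m))
  neg-const : ∀ c → ⊝ const c ≋ const (- c)
  neg-const c .at zero    = refl
  neg-const c .at (suc _) = refl
  u-def : oneMinusQ (suc m) ≋ const 1ℚ ⊕ ⊝ x
  u-def = ≋-trans (oneMinusQ≋ m) (oneS⊕≋ (⊝ x))

dlog-geomQ : ∀ m → geomQ (suc m) dlog const (ℕtoℚ (suc m)) ⊗ G (suc m)
dlog-geomQ m = dlog-congˡ (≋-sym v-def) (by-dlog (begin
  θ (const 1ℚ ⊕ G (suc m))                    ≈⟨ ≋-trans (θ-⊕ (const 1ℚ) (G (suc m))) (⊕-cong (θ-const 1ℚ) (θ-G m)) ⟩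
  const 0ℚ ⊕ n ⊗ (G (suc m) ⊗ G (suc m) ⊕ G (suc m))
    ≈⟨ S.solve 2 (λ n g → S.con 0ℚ S.:+ n S.:* (g S.:* g S.:+ g) S.:= n S.:* g S.:* (S.con 1ℚ S.:+ g)) ≋-refl n (G (suc m)) ⟩
  n ⊗ G (suc m) ⊗ (const 1ℚ ⊕ G (suc m))      ∎))
  where
  open ≋-Reasoning
  n = const (ℕtoℚ (suc m))
  v-def : geomQ (suc m) ≋ const 1ℚ ⊕ G (suc m)
  v-def = ≋-trans (S.solve 2 (λ v o → v S.:= o S.:+ (v S.:- o)) ≋-refl (geomQ (suc m)) oneS) (oneS⊕≋ (G (suc m)))

-- The logarithmic derivative of 1/Π(1-q^{mk}).
ηlog : ℕ → Series
ηlog m n = sum1To n (λ k → ℕtoℚ (m ℕ.* k) * G (m ℕ.* k) n)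

private
  k<m*k : ∀ m {j k} → j < k → j < suc m ℕ.* k
  k<m*k m {j} {k} j<k = ℕₚ.<-≤-trans j<k (ℕₚ.m≤m+n k (m ℕ.* k))

  -- Common to the products of 1 - q^{mk} and of their inverses: the constant `c` is -1 for the
  -- former and 1 for the latter.
  factor-dlog : ∀ {F : ℕ → Series} {c : ℚ} → (∀ m → F (suc m) dlog const (c * ℕtoℚ (suc m)) ⊗ G (suc m)) →
    (∀ m j → j < m → F m j ≡ oneS j) → ∀ m e →
    prodInf (λ k → powS (F (suc m ℕ.* k)) e) dlog const (ℕtoℚ e * c) ⊗ ηlog (suc m)
  factor-dlog {F} {c} dF F-< m e = dlog-congʳ {prodInf (λ k → powS (F (suc m ℕ.* k)) e)} ℓ-sum
    (dlog-prodInf {λ k → powS (F (suc m ℕ.* k)) e} {ℓ}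
      (λ k → dlog-powS {F (suc m ℕ.* suc k)} e (dF (k ℕ.+ m ℕ.* suc k)))
      (λ k → powS-≡oneS e (λ i i<1+k → F-< (suc m ℕ.* suc k) i (k<m*k m i<1+k)))
      (λ k j j<k → trans (ℓ-at k j) (trans (cong (ℕtoℚ e * c *_) (trans (cong (ℕtoℚ (suc m ℕ.* k) *_)
         (G-< (suc m ℕ.* k) j (k<m*k m j<k))) (*-zeroʳ (ℕtoℚ (suc m ℕ.* k))))) (*-zeroʳ (ℕtoℚ e * c)))))
    where
    ℓ : ℕ → Series
    ℓ k = const (ℕtoℚ e) ⊗ (const (c * ℕtoℚ (suc m ℕ.* k)) ⊗ G (suc m ℕ.* k))
    ℓ-at : ∀ k j → ℓ k j ≡ ℕtoℚ e * c * (ℕtoℚ (suc m ℕ.* k) * G (suc m ℕ.* k) j)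
    ℓ-at k j = trans (const-⊛ (ℕtoℚ e) (const (c * ℕtoℚ (suc m ℕ.* k)) ⊗ G (suc m ℕ.* k)) j)
      (trans (cong (ℕtoℚ e *_) (const-⊛ (c * ℕtoℚ (suc m ℕ.* k)) (G (suc m ℕ.* k)) j))
        (Q.solve 4 (λ e c n g → e Q.:* (c Q.:* n Q.:* g) Q.:= e Q.:* c Q.:* (n Q.:* g)) refl (ℕtoℚ e) c (ℕtoℚ (suc m ℕ.* k)) (G (suc m ℕ.* k) j)))
    ℓ-sum : (λ j → sum1To j (λ k → ℓ k j)) ≋ const (ℕtoℚ e * c) ⊗ ηlog (suc m)
    ℓ-sum .at j = trans (sum1To-cong j (λ k _ → ℓ-at (suc k) j))
      (trans (sum1To-*ˡ j (ℕtoℚ e * c) (λ k → ℕtoℚ (suc m ℕ.* k) * G (suc m ℕ.* k) j)) (sym (const-⊛ (ℕtoℚ e * c) (ηlog (suc m)) j)))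

dlog-etaProdPos : ∀ m e → etaProdPos (suc m) e dlog const (ℕtoℚ e * - 1ℚ) ⊗ ηlog (suc m)
dlog-etaProdPos = factor-dlog {oneMinusQ} { - 1ℚ}
  (λ m → dlog-congʳ {oneMinusQ (suc m)} (⊛-cong (const-cong (Q.solve 1 (λ n → Q.:- n Q.:= Q.con (- 1ℚ) Q.:* n) refl (ℕtoℚ (suc m)))) (≋-refl {G (suc m)})) (dlog-oneMinusQ m))
  oneMinusQ-<

dlog-etaProdNeg : ∀ m e → etaProdNeg (suc m) e dlog const (ℕtoℚ e * 1ℚ) ⊗ ηlog (suc m)
dlog-etaProdNeg = factor-dlog {geomQ} {1ℚ}
  (λ m → dlog-congʳ {geomQ (suc m)} (⊛-cong (const-cong (sym (*-identityˡ (ℕtoℚ (suc m))))) (≋-refl {G (suc m)})) (dlog-geomQ m))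
  geomQ-<

ηlog-1 : ηlog 1 ≋ L ℕtoℚ
ηlog-1 .at n = sum1To-cong n (λ k _ → cong (λ j → ℕtoℚ j * G j n) (ℕₚ.*-identityˡ (suc k)))

multipleOf3 : Residue → ℚ
multipleOf3 r₀ = 1ℚ
multipleOf3 r₁ = 0ℚ
multipleOf3 r₂ = 0ℚ

ε : QuasiPoly
ε r = Q.con (multipleOf3 r) Q.:* 𝕕 r

-- The sum over d is extended to 3n, where blocks of three consecutive terms each leave only the
-- multiple of 3; the terms beyond n vanish because `G d` begins in degree d.
ηlog-3 : ηlog 3 ≋ L ⟪ ε ⟫
ηlog-3 .at n = begin
  sum1To n (λ k → ℕtoℚ (3 ℕ.* k) * G (3 ℕ.* k) n)   ≡⟨ thin n ⟨
  sum1To (3 ℕ.* n) entry                             ≡⟨ sum1To-trunc (ℕₚ.m≤m+n n (2 ℕ.* n)) (λ k n<k → trans (cong (weight k *_) (G-< k n n<k)) (*-zeroʳ (weight k))) ⟩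
  sum1To n entry                                     ∎
  where
  open ≡-Reasoning
  weight entry : ℕ → ℚ
  weight k = multipleOf3 (residue k) * ℕtoℚ k
  entry k = weight k * G k n
  3* : ∀ m → 3 ℕ.* suc m ≡ suc (suc (suc (3 ℕ.* m)))
  3* m = ℕₚ.*-suc 3 m
  residue-3* : ∀ m → residue (3 ℕ.* m) ≡ r₀
  residue-3* zero    = refl
  residue-3* (suc m) = trans (cong residue (3* m)) (cong (λ r → next (next (next r))) (residue-3* m))
  entry-val : ∀ k {r} → residue k ≡ r → entry k ≡ multipleOf3 r * (ℕtoℚ k * G k n)
  entry-val k refl = *-assoc (multipleOf3 (residue k)) (ℕtoℚ k) (G k n)
  thin : ∀ m → sum1To (3 ℕ.* m) entry ≡ sum1To m (λ k → ℕtoℚ (3 ℕ.* k) * G (3 ℕ.* k) n)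
  thin zero    = refl
  thin (suc m) = begin
    sum1To (3 ℕ.* suc m) entry
      ≡⟨ cong (λ j → sum1To j entry) (3* m) ⟩
    sum1To (3 ℕ.* m) entry + entry (suc (3 ℕ.* m)) + entry (suc (suc (3 ℕ.* m))) + entry (suc (suc (suc (3 ℕ.* m))))
      ≡⟨ cong₂ _+_ (cong₂ _+_ (cong₂ _+_ (thin m) (trans (entry-val (suc (3 ℕ.* m)) {r₁} (cong next (residue-3* m))) (*-zeroˡ _′)))
           (trans (entry-val (suc (suc (3 ℕ.* m))) {r₂} (cong (λ r → next (next r)) (residue-3* m))) (*-zeroˡ u₂)))
           (trans (cong entry (sym (3* m))) (trans (entry-val (3 ℕ.* suc m) {r₀} (residue-3* (suc m))) (*-identityˡ u₃))) ⟩
    s + 0ℚ + 0ℚ + u₃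
      ≡⟨ cong (_+ u₃) (trans (+-identityʳ (s + 0ℚ)) (+-identityʳ s)) ⟩
    s + u₃ ∎
    where
    s = sum1To m (λ k → ℕtoℚ (3 ℕ.* k) * G (3 ℕ.* k) n)
    _′ = ℕtoℚ (suc (3 ℕ.* m)) * G (suc (3 ℕ.* m)) n
    u₂ = ℕtoℚ (suc (suc (3 ℕ.* m))) * G (suc (suc (3 ℕ.* m))) n
    u₃ = ℕtoℚ (3 ℕ.* suc m) * G (3 ℕ.* suc m) n

-- The six Liouville identities

𝕩² 𝕕² 𝕕³ 𝕕⁴ : QuasiPoly
𝕩² = 𝕩 *ₚ 𝕩
𝕕² = 𝕕 *ₚ 𝕕
𝕕³ = 𝕕² *ₚ 𝕕
𝕕⁴ = 𝕕³ *ₚ 𝕕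

-- With 𝕩 = χ₃(d) and 𝕕 = d, Σ𝕩²𝕕² is the summand χ₃(d)²d² together with its partial sums.
Σ1 Σ𝕩 Σ𝕩² Σ𝕕 Σ𝕩𝕕 Σ𝕩²𝕕 Σ𝕕² Σ𝕩𝕕² Σ𝕩²𝕕² Σ𝕩𝕕³ : Summand

Σ1 = record { term = 1ₚ ; partial = 𝕕 ; base = refl ; step = each refl refl refl }

Σ𝕩 = record
  { term = 𝕩 ; partial = frac 1 2 · (𝕩 +ₚ 𝕩²)
  ; base = refl ; step = each refl refl refl }

Σ𝕩² = record
  { term = 𝕩² ; partial = frac 1 2 · 𝕩² -ₚ frac 1 6 · 𝕩 +ₚ frac 2 3 · 𝕕
  ; base = refl ; step = each refl refl refl }

Σ𝕕 = record
  { term = 𝕕 ; partial = frac 1 2 · (𝕕 +ₚ 𝕕²)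
  ; base = refl ; step = each refl refl refl }

Σ𝕩𝕕 = record
  { term = 𝕩 *ₚ 𝕕
  ; partial = frac 1 3 · (𝕩 -ₚ 𝕕) +ₚ frac 1 2 · ((𝕩 +ₚ 𝕩²) *ₚ 𝕕)
  ; base = refl ; step = each refl refl refl }

Σ𝕩²𝕕 = record
  { term = 𝕩² *ₚ 𝕕
  ; partial = frac 1 3 · (𝕩² +ₚ 𝕕²) +ₚ (frac 1 2 · 𝕩² -ₚ frac 1 6 · 𝕩) *ₚ 𝕕
  ; base = refl ; step = each refl refl refl }

Σ𝕕² = record
  { term = 𝕕² ; partial = frac 1 6 · 𝕕 +ₚ frac 1 2 · 𝕕² +ₚ frac 1 3 · 𝕕³
  ; base = refl ; step = each refl refl refl }

Σ𝕩𝕕² = record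
  { term = 𝕩 *ₚ 𝕕²
  ; partial = frac 2 3 · (𝕩 *ₚ 𝕕) -ₚ frac 1 3 · (𝕩² +ₚ 𝕕²) +ₚ frac 1 2 · ((𝕩 +ₚ 𝕩²) *ₚ 𝕕²)
  ; base = refl ; step = each refl refl refl }

Σ𝕩²𝕕² = record
  { term = 𝕩² *ₚ 𝕕²
  ; partial = frac 1 9 · 𝕩 -ₚ frac 1 3 · 𝕕 +ₚ frac 2 3 · (𝕩² *ₚ 𝕕) +ₚ (frac 1 2 · 𝕩² -ₚ frac 1 6 · 𝕩) *ₚ 𝕕² +ₚ frac 2 9 · 𝕕³
  ; base = refl ; step = each refl refl refl }

Σ𝕩𝕕³ = record
  { term = 𝕩 *ₚ 𝕕³
  ; partial = frac 2 3 · 𝕕 -ₚ frac 1 3 · 𝕩 -ₚ 𝕩² *ₚ 𝕕 +ₚ 𝕩 *ₚ 𝕕² -ₚ frac 1 3 · 𝕕³ +ₚ frac 1 2 · ((𝕩 +ₚ 𝕩²) *ₚ 𝕕³)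
  ; base = refl ; step = each refl refl refl }

-- `γ` is 3d minus d when 3 divides d, from the exponents of η(τ)³/η(3τ); `δ` is d restricted to d
-- prime to 3, from η(3τ)/η(τ). The name `η` is not the Dedekind function: `L ⟪ η ⟫` is 27 (E₄(τ) -
-- E₄(3τ))/240, the weight-4 term of the differential system.
γ δ η 𝕩𝕕² 𝕩𝕕⁴ : QuasiPoly
γ = frac 2 1 · 𝕕 +ₚ 𝕩² *ₚ 𝕕
δ = 𝕩² *ₚ 𝕕
η = frac 26 1 · 𝕕³ +ₚ 𝕩² *ₚ 𝕕³
𝕩𝕕² = 𝕩 *ₚ 𝕕²
𝕩𝕕⁴ = 𝕩 *ₚ 𝕕⁴

-- The kernels below were found by solving g(d,e) - g(d,d+e) = α(d)β(e) + α(e)β(d), a linear system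
-- over the quasi-polynomials in d and e.
liouville-𝕩-𝕩 = quasi-liouville ((1ℚ , 𝕩) ∷ []) ((1ℚ , 𝕩) ∷ []) []
  ((frac 2 3 , 𝕩) ∷ (- frac 2 3 , δ) ∷ [])
  (Σ𝕩 ⊠ 𝕩 ∷ Σ𝕩² ⊠ (0ₚ -ₚ 𝕩²) ∷ [])
  (each² refl refl refl refl refl refl refl refl refl) (each² refl refl refl refl refl refl refl refl refl)
  (each refl refl refl) (each refl refl refl)

-- The first factor 2γ - 8δ is -2/3 times the nonconstant part 12δ - 3γ of `s` + 3`β`.
liouville-ψ-𝕩 = quasi-liouville ((frac 2 1 , γ) ∷ (- frac 8 1 , δ) ∷ []) ((1ℚ , 𝕩) ∷ []) ((- frac 4 1 , 𝕩) ∷ [])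
  ((frac 2 3 , γ) ∷ (- frac 8 3 , δ) ∷ (- frac 4 3 , 𝕩) ∷ (- frac 2 1 , 𝕩𝕕²) ∷ [])
  ( Σ1   ⊠ (0ₚ -ₚ 4 ·· 𝕩 *ₚ 𝕕)
  ∷ Σ𝕩   ⊠ (2 ·· 𝕕 -ₚ 3 ·· 𝕩² *ₚ 𝕕)
  ∷ Σ𝕩²  ⊠ 3 ·· 𝕩 *ₚ 𝕕
  ∷ Σ𝕕   ⊠ 2 ·· 𝕩
  ∷ Σ𝕩𝕕  ⊠ (3 ·· 𝕩² -ₚ 4 ·· 1ₚ)
  ∷ Σ𝕩²𝕕 ⊠ (0ₚ -ₚ 3 ·· 𝕩)
  ∷ [])
  (each² refl refl refl refl refl refl refl refl refl) (each² refl refl refl refl refl refl refl refl refl)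
  (each refl refl refl) (each refl refl refl)

liouville-γ-γ = quasi-liouville ((1ℚ , γ) ∷ []) ((1ℚ , γ) ∷ []) ((- frac 2 1 , γ) ∷ []) ((- frac 2 9 , η) ∷ [])
  ( Σ1    ⊠ (0ₚ -ₚ 4 ·· 𝕕² -ₚ 2 ·· 𝕩² *ₚ 𝕕²)
  ∷ Σ𝕩²   ⊠ (2 ·· 𝕩² *ₚ 𝕕² -ₚ 4 ·· 𝕕²)
  ∷ Σ𝕕    ⊠ (4 ·· 𝕕 +ₚ 2 ·· 𝕩² *ₚ 𝕕)
  ∷ Σ𝕩𝕕   ⊠ 𝕩 *ₚ 𝕕
  ∷ Σ𝕩²𝕕  ⊠ (2 ·· 𝕕 +ₚ 𝕩² *ₚ 𝕕)
  ∷ Σ𝕕²   ⊠ (0ₚ -ₚ 4 ·· 1ₚ -ₚ 4 ·· 𝕩²)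
  ∷ Σ𝕩²𝕕² ⊠ (2 ·· 𝕩² -ₚ 2 ·· 1ₚ)
  ∷ [])
  (each² refl refl refl refl refl refl refl refl refl) (each² refl refl refl refl refl refl refl refl refl)
  (each refl refl refl) (each refl refl refl)

liouville-γ-δ = quasi-liouville ((frac 3 1 , γ) ∷ []) ((1ℚ , δ) ∷ []) ((- frac 3 1 , δ) ∷ []) ((frac 1 2 , γ) ∷ (- frac 1 6 , η) ∷ [])
  ( Σ1    ⊠ (0ₚ -ₚ 3 ·· 𝕩² *ₚ 𝕕²)
  ∷ Σ𝕩²   ⊠ (3 ·· 𝕩² *ₚ 𝕕² -ₚ 7 ·· 𝕕²)
  ∷ Σ𝕕    ⊠ 3 ·· 𝕩² *ₚ 𝕕
  ∷ Σ𝕩𝕕   ⊠ 2 ·· 𝕩 *ₚ 𝕕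
  ∷ Σ𝕩²𝕕  ⊠ (3 ·· 𝕕 +ₚ 3 ·· 𝕩² *ₚ 𝕕)
  ∷ Σ𝕕²   ⊠ (0ₚ -ₚ 7 ·· 𝕩²)
  ∷ Σ𝕩²𝕕² ⊠ (3 ·· 𝕩² -ₚ 3 ·· 1ₚ)
  ∷ [])
  (each² refl refl refl refl refl refl refl refl refl) (each² refl refl refl refl refl refl refl refl refl)
  (each refl refl refl) (each refl refl refl)

liouville-γ-𝕩𝕕² = quasi-liouville ((frac 6 1 , γ) ∷ []) ((1ℚ , 𝕩𝕕²) ∷ []) ((- frac 4 1 , 𝕩𝕕²) ∷ []) ((- frac 4 3 , γ) ∷ [])
  ( Σ1    ⊠ (0ₚ -ₚ 4 ·· 𝕩 *ₚ 𝕕³)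
  ∷ Σ𝕩²   ⊠ 4 ·· 𝕩 *ₚ 𝕕³
  ∷ Σ𝕕    ⊠ 6 ·· 𝕩 *ₚ 𝕕²
  ∷ Σ𝕩𝕕   ⊠ (0ₚ -ₚ 2 ·· 𝕕² -ₚ 9 ·· 𝕩² *ₚ 𝕕²)
  ∷ Σ𝕩²𝕕  ⊠ 3 ·· 𝕩 *ₚ 𝕕²
  ∷ Σ𝕕²   ⊠ (0ₚ -ₚ 2 ·· 𝕩 *ₚ 𝕕)
  ∷ Σ𝕩𝕕²  ⊠ (6 ·· 𝕕 +ₚ 3 ·· 𝕩² *ₚ 𝕕)
  ∷ Σ𝕩²𝕕² ⊠ (0ₚ -ₚ 9 ·· 𝕩 *ₚ 𝕕)
  ∷ Σ𝕩𝕕³  ⊠ (4 ·· 𝕩² -ₚ 4 ·· 1ₚ)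
  ∷ [])
  (each² refl refl refl refl refl refl refl refl refl) (each² refl refl refl refl refl refl refl refl refl)
  (each refl refl refl) (each refl refl refl)

liouville-δ-𝕩𝕕² = quasi-liouville ((frac 2 1 , δ) ∷ []) ((1ℚ , 𝕩𝕕²) ∷ []) []
  ((frac 1 3 , 𝕩𝕕²) ∷ (frac 1 9 , 𝕩𝕕⁴) ∷ (- frac 4 9 , δ) ∷ [])
  ( Σ𝕩𝕕   ⊠ (0ₚ -ₚ 𝕩² *ₚ 𝕕²)
  ∷ Σ𝕩²𝕕  ⊠ 𝕩 *ₚ 𝕕²
  ∷ Σ𝕩𝕕²  ⊠ 𝕩² *ₚ 𝕕
  ∷ Σ𝕩²𝕕² ⊠ (0ₚ -ₚ 𝕩 *ₚ 𝕕)
  ∷ [])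
  (each² refl refl refl refl refl refl refl refl refl) (each² refl refl refl refl refl refl refl refl refl)
  (each refl refl refl) (each refl refl refl)

-- Composition with a series without constant term

sumTo-swap : ∀ m n (F : ℕ → ℕ → ℚ) → sumTo m (λ i → sumTo n (F i)) ≡ sumTo n (λ j → sumTo m (λ i → F i j))
sumTo-swap zero    n F = refl
sumTo-swap (suc m) n F = trans (cong (_+ sumTo n (F (suc m))) (sumTo-swap m n F))
  (sym (sumTo-+ n (λ j → sumTo m (λ i → F i j)) (F (suc m))))

sumTo-trunc : ∀ {m n} {f : ℕ → ℚ} → m ≤ n → (∀ k → m < k → f k ≡ 0ℚ) → sumTo n f ≡ sumTo m f
sumTo-trunc {m} {zero}  z≤n f≡0 = refl
sumTo-trunc {m} {suc n} {f} m≤1+n f≡0 with m ℕ.≟ suc n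
... | yes refl = refl
... | no m≢1+n = trans (cong₂ _+_ (sumTo-trunc {m} {n} {f} m≤n f≡0) (f≡0 (suc n) (s≤s m≤n))) (+-identityʳ (sumTo m f))
  where m≤n = ℕₚ.≤-pred (ℕₚ.≤∧≢⇒< m≤1+n m≢1+n)

const-* : ∀ c d → const (c * d) ≋ const c ⊗ const d
const-* c d .at zero    = refl
const-* c d .at (suc n) = sym (trans (const-⊛ c (const d) (suc n)) (*-zeroʳ c))

module _ (u : Series) where
  private
    t : Series
    t = shiftUp u

  t-⊛-suc : ∀ f n → (t ⊛ f) (suc n) ≡ (u ⊛ f) n
  t-⊛-suc f n = shiftUp-⊛ u f .at (suc n)

  t-⊛-cong : ∀ {f g : Series} n → (∀ {k} → k < n → f k ≡ g k) → (t ⊛ f) n ≡ (t ⊛ g) n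
  t-⊛-cong {f} {g} zero    eq = trans (*-zeroˡ (f 0)) (sym (*-zeroˡ (g 0)))
  t-⊛-cong {f} {g} (suc n) eq = trans (t-⊛-suc f n)
    (trans (⊛-cong-≤ n {u} {u} (λ _ _ → refl) (λ k k≤n → eq (s≤s k≤n))) (sym (t-⊛-suc g n)))

  powS-< : ∀ n k → k < n → powS t n k ≡ 0ℚ
  powS-< (suc n) zero    _         = *-zeroˡ (powS t n 0)
  powS-< (suc n) (suc k) (s≤s k<n) = trans (t-⊛-suc (powS t n) k) (⊛-< {u} {powS t n} 0 n (λ _ ()) (powS-< n) k k<n)

  compose : Series → Series
  compose c = composeS c t

  compose-cong : ∀ {c c′} → c ≋ c′ → compose c ≋ compose c′
  compose-cong c≋ .at n = sumTo-cong n (λ k _ → cong (_* powS t k n) (c≋ .at k))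

  compose-⊕ : ∀ c c′ → compose (c ⊕ c′) ≋ compose c ⊕ compose c′
  compose-⊕ c c′ .at n = trans (sumTo-cong n (λ k _ → *-distribʳ-+ (powS t k n) (c k) (c′ k)))
    (sumTo-+ n (λ k → c k * powS t k n) (λ k → c′ k * powS t k n))

  compose-const-⊗ : ∀ a c → compose (const a ⊗ c) ≋ const a ⊗ compose c
  compose-const-⊗ a c .at n = trans
    (sumTo-cong n (λ k _ → trans (cong (_* powS t k n) (const-⊛ a c k)) (*-assoc a (c k) (powS t k n))))
    (trans (sumTo-*ˡ n a (λ k → c k * powS t k n)) (sym (const-⊛ a (compose c) n)))

  -- Horner's rule. In degree n the factor `t` leaves only lower degrees of what it multiplies, so
  -- the product and chain rules below follow by strong induction on the degree.
  compose-unfold : ∀ c → compose c ≋ const (c 0) ⊕ t ⊗ compose (shiftDown c)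
  compose-unfold c .at zero    = trans (*-identityʳ (c 0)) (sym (trans (cong (c 0 +_) (*-zeroˡ (compose (shiftDown c) 0))) (+-identityʳ (c 0))))
  compose-unfold c .at (suc n) = begin
    sumTo (suc n) (λ k → c k * powS t k (suc n))
      ≡⟨ sumTo-split n (λ k → c k * powS t k (suc n)) ⟩
    c 0 * 0ℚ + sumTo n (λ k → c (suc k) * powS t (suc k) (suc n))
      ≡⟨ cong₂ _+_ (*-zeroʳ (c 0)) (sumTo-cong n (λ k _ → inner k)) ⟩
    0ℚ + sumTo n (λ k → sumTo n (λ i → u i * (c (suc k) * powS t k (n ∸ i))))
      ≡⟨ cong (0ℚ +_) (trans (sumTo-swap n n (λ k i → u i * (c (suc k) * powS t k (n ∸ i)))) (sumTo-cong n (λ i _ → collect i))) ⟩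
    0ℚ + (u ⊛ compose (shiftDown c)) n
      ≡⟨ cong (0ℚ +_) (t-⊛-suc (compose (shiftDown c)) n) ⟨
    0ℚ + (t ⊛ compose (shiftDown c)) (suc n) ∎
    where
    open ≡-Reasoning
    inner : ∀ k → c (suc k) * powS t (suc k) (suc n) ≡ sumTo n (λ i → u i * (c (suc k) * powS t k (n ∸ i)))
    inner k = trans (cong (c (suc k) *_) (t-⊛-suc (powS t k) n))
      (trans (sym (sumTo-*ˡ n (c (suc k)) (λ i → u i * powS t k (n ∸ i))))
        (sumTo-cong n (λ i _ → Q.solve 3 (λ c u p → c Q.:* (u Q.:* p) Q.:= u Q.:* (c Q.:* p)) refl (c (suc k)) (u i) (powS t k (n ∸ i)))))
    collect : ∀ i → sumTo n (λ k → u i * (c (suc k) * powS t k (n ∸ i))) ≡ u i * compose (shiftDown c) (n ∸ i)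
    collect i = trans (sumTo-*ˡ n (u i) (λ k → c (suc k) * powS t k (n ∸ i)))
      -- The powers of `t` with exponent above n - i vanish in degree n - i, so the sum up to n is
      -- already the coefficient of the composite.
      (cong (u i *_) (sumTo-trunc (ℕₚ.m∸n≤m n i) (λ k n-i<k → trans (cong (c (suc k) *_) (powS-< k (n ∸ i) n-i<k)) (*-zeroʳ (c (suc k))))))

  compose-shiftUp : ∀ c → compose (shiftUp c) ≋ t ⊗ compose c
  compose-shiftUp c = ≋-trans (compose-unfold (shiftUp c)) (S.solve 1 (λ y → S.con 0ℚ S.:+ y S.:= y) ≋-refl (t ⊗ compose c))

  -- Applying Horner's rule to `f ⊛ g` leaves one composite of a product, that of `shiftDown f` with
  -- `g`, and it stands under a factor `t`; the induction hypothesis applies there.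
  compose-⊛ : ∀ f g → compose (f ⊛ g) ≋ compose f ⊗ compose g
  compose-⊛ f g .at n = <-rec (λ n → ∀ f g → compose (f ⊛ g) n ≡ (compose f ⊗ compose g) n) step n f g
    where
    step : ∀ n → (∀ {k} → k < n → ∀ f g → compose (f ⊛ g) k ≡ (compose f ⊗ compose g) k) →
      ∀ f g → compose (f ⊛ g) n ≡ (compose f ⊗ compose g) n
    step n ih f g = begin
      compose (f ⊛ g) n
        ≡⟨ compose-unfold (f ⊛ g) .at n ⟩
      const (f 0 * g 0) n + (t ⊗ compose (shiftDown (f ⊛ g))) n
        ≡⟨ cong (const (f 0 * g 0) n +_) (trans (⊛-cong (≋-refl {t}) tail .at n)
             (t-⊛-cong {const (f 0) ⊗ compose g′ ⊕ compose (f′ ⊛ g)} {const (f 0) ⊗ compose g′ ⊕ compose f′ ⊗ compose g} n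
               (λ {k} k<n → cong ((const (f 0) ⊗ compose g′) k +_) (ih k<n f′ g)))) ⟩
      (const (f 0 * g 0) ⊕ t ⊗ (const (f 0) ⊗ compose g′ ⊕ compose f′ ⊗ compose g)) n
        ≡⟨ rearrange .at n ⟩
      (compose f ⊗ compose g) n ∎
      where
      open ≡-Reasoning
      f′ = shiftDown f
      g′ = shiftDown g
      tail : compose (shiftDown (f ⊛ g)) ≋ const (f 0) ⊗ compose g′ ⊕ compose (f′ ⊛ g)
      tail = ≋-trans (compose-cong {shiftDown (f ⊛ g)} {const (f 0) ⊗ g′ ⊕ f′ ⊛ g}
          (pointwise λ k → trans (⊛-suc f g k) (cong (_+ (f′ ⊛ g) k) (sym (const-⊛ (f 0) g′ k)))))
        (≋-trans (compose-⊕ (const (f 0) ⊗ g′) (f′ ⊛ g)) (⊕-cong (compose-const-⊗ (f 0) g′) (≋-refl {compose (f′ ⊛ g)})))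
      rearrange : const (f 0 * g 0) ⊕ t ⊗ (const (f 0) ⊗ compose g′ ⊕ compose f′ ⊗ compose g) ≋ compose f ⊗ compose g
      rearrange = ≋-trans (⊕-cong (const-* (f 0) (g 0)) (⊛-cong (≋-refl {t})
            (⊕-cong (≋-refl {const (f 0) ⊗ compose g′}) (⊛-cong (≋-refl {compose f′}) (compose-unfold g)))))
        (≋-trans (S.solve 5 (λ a b t f′ g′ → a S.:* b S.:+ t S.:* (a S.:* g′ S.:+ f′ S.:* (b S.:+ t S.:* g′)) S.:= (a S.:+ t S.:* f′) S.:* (b S.:+ t S.:* g′))
            ≋-refl (const (f 0)) (const (g 0)) t (compose f′) (compose g′))
          (⊛-cong (≋-sym (compose-unfold f)) (≋-sym (compose-unfold g))))

  compose-powS : ∀ f e → compose (powS f e) ≋ powS (compose f) e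
  compose-powS f zero    = ≋-trans (compose-cong oneS≋const) (≋-trans (compose-unfold (const 1ℚ))
    (≋-trans (⊕-cong (≋-sym oneS≋const) (⊛-cong (≋-refl {t}) compose-0)) (S.solve 2 (λ t o → o S.:+ t S.:* S.con 0ℚ S.:= o) ≋-refl t oneS)))
    where
    compose-0 : compose (λ _ → 0ℚ) ≋ const 0ℚ
    compose-0 .at n = trans (sumTo-zero n (λ k _ → *-zeroˡ (powS t k n))) (sym (const-0 n))
  compose-powS f (suc e) = ≋-trans (compose-⊛ f (powS f e)) (⊛-cong (≋-refl {compose f}) (compose-powS f e))

  -- The chain rule: on coefficient sequences `θ` is t d/dt, and θ t = s t. Differentiating Horner's
  -- form puts the claim for `shiftDown c` under a factor `t`.
  θ-compose : ∀ {s} → t dlog s → ∀ c → θ (compose c) ≋ s ⊗ compose (θ c)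
  θ-compose {s} dt c .at n = <-rec (λ n → ∀ c → θ (compose c) n ≡ (s ⊗ compose (θ c)) n) step n c
    where
    step : ∀ n → (∀ {k} → k < n → ∀ c → θ (compose c) k ≡ (s ⊗ compose (θ c)) k) → ∀ c → θ (compose c) n ≡ (s ⊗ compose (θ c)) n
    step n ih c = begin
      θ (compose c) n
        ≡⟨ expand .at n ⟩
      (s ⊗ t ⊗ C) n + (t ⊗ θ C) n
        ≡⟨ cong ((s ⊗ t ⊗ C) n +_) (t-⊛-cong {θ C} {s ⊗ compose (θ c′)} n (λ k<n → ih k<n c′)) ⟩
      (s ⊗ t ⊗ C) n + (t ⊗ (s ⊗ compose (θ c′))) n
        ≡⟨ collapse .at n ⟩
      (s ⊗ compose (θ c)) n ∎
      where
      open ≡-Reasoning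
      c′ = shiftDown c
      C = compose c′
      expand : θ (compose c) ≋ s ⊗ t ⊗ C ⊕ t ⊗ θ C
      expand = ≋-trans (θ-cong (compose-unfold c)) (≋-trans (θ-⊕ (const (c 0)) (t ⊗ C))
        (≋-trans (⊕-cong (θ-const (c 0)) (≋-trans (θ-⊗ t C) (⊕-cong (⊛-cong (dt .θ-dlog) (≋-refl {C})) (≋-refl {t ⊗ θ C}))))
          (S.solve 2 (λ a b → S.con 0ℚ S.:+ (a S.:+ b) S.:= a S.:+ b) ≋-refl (s ⊗ t ⊗ C) (t ⊗ θ C))))
      tail : shiftDown (θ c) ≋ c′ ⊕ θ c′
      tail .at k = trans (cong (_* c (suc k)) (ℕtoℚ-suc k))
        (Q.solve 2 (λ n x → (Q.con 1ℚ Q.:+ n) Q.:* x Q.:= x Q.:+ n Q.:* x) refl (ℕtoℚ k) (c (suc k)))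
      collapse : s ⊗ t ⊗ C ⊕ t ⊗ (s ⊗ compose (θ c′)) ≋ s ⊗ compose (θ c)
      collapse = ≋-trans (S.solve 4 (λ s t x y → s S.:* t S.:* x S.:+ t S.:* (s S.:* y) S.:= s S.:* (S.con 0ℚ S.:+ t S.:* (x S.:+ y))) ≋-refl s t C (compose (θ c′)))
        (⊛-cong (≋-refl {s}) (≋-sym (≋-trans (compose-unfold (θ c)) (⊕-cong (const-cong (*-zeroˡ (c 0)))
          (⊛-cong (≋-refl {t}) (≋-trans (compose-cong tail) (compose-⊕ c′ (θ c′))))))))

-- The hypergeometric coefficients

-- The n-th power of -27, so that `rescale` substitutes -27z for z.
twist : ℕ → ℚ
twist n = signℚ n * ℕtoℚ (27 ℕ.^ n)

twist-suc : ∀ n → twist (suc n) ≡ - ℕtoℚ 27 * twist n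
twist-suc n = trans (cong (- signℚ n *_) (ℕtoℚ-* 27 (27 ℕ.^ n)))
  (Q.solve 3 (λ s a b → (Q.:- s) Q.:* (a Q.:* b) Q.:= (Q.:- a) Q.:* (s Q.:* b)) refl (signℚ n) (ℕtoℚ 27) (ℕtoℚ (27 ℕ.^ n)))

twist-+ : ∀ m n → twist (m ℕ.+ n) ≡ twist m * twist n
twist-+ zero    n = sym (*-identityˡ (twist n))
twist-+ (suc m) n = begin
  twist (suc (m ℕ.+ n))               ≡⟨ twist-suc (m ℕ.+ n) ⟩
  - ℕtoℚ 27 * twist (m ℕ.+ n)         ≡⟨ cong (- ℕtoℚ 27 *_) (twist-+ m n) ⟩
  - ℕtoℚ 27 * (twist m * twist n)     ≡⟨ *-assoc (- ℕtoℚ 27) (twist m) (twist n) ⟨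
  - ℕtoℚ 27 * twist m * twist n       ≡⟨ cong (_* twist n) (twist-suc m) ⟨
  twist (suc m) * twist n             ∎
  where open ≡-Reasoning

rescale : Series → Series
rescale f n = twist n * f n

rescale-⊛ : ∀ f g → rescale (f ⊛ g) ≋ rescale f ⊛ rescale g
rescale-⊛ f g .at n = trans (sym (sumTo-*ˡ n (twist n) (λ k → f k * g (n ∸ k))))
  (sumTo-cong n (λ k k≤n → trans (cong (_* (f k * g (n ∸ k))) (trans (cong twist (sym (ℕₚ.m+[n∸m]≡n k≤n))) (twist-+ k (n ∸ k))))
    (Q.solve 4 (λ a b c d → a Q.:* b Q.:* (c Q.:* d) Q.:= a Q.:* c Q.:* (b Q.:* d)) refl (twist k) (twist (n ∸ k)) (f k) (g (n ∸ k)))))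

rescale-powS : ∀ f e → rescale (powS f e) ≋ powS (rescale f) e
rescale-powS f zero    = pointwise λ { zero → refl ; (suc n) → *-zeroʳ (twist (suc n)) }
rescale-powS f (suc e) = ≋-trans (rescale-⊛ f (powS f e)) (⊛-cong (≋-refl {rescale f}) (rescale-powS f e))

B≋ : B ≋ powS (rescale F21) 3
B≋ = ≋-trans (pointwise λ n → sym (*-assoc (signℚ n) (ℕtoℚ (27 ℕ.^ n)) (powS F21 3 n))) (rescale-powS F21 3)

pochRatio-suc : ∀ n → ℕtoℚ 3 * ℕtoℚ (suc n) * pochRatio (suc n) ≡ (ℕtoℚ 3 * ℕtoℚ n + 1ℚ) * pochRatio n
pochRatio-suc n = begin
  ℕtoℚ 3 * ℕtoℚ (suc n) * (pochRatio n * r)   ≡⟨ cong (_* (pochRatio n * r)) (ℕtoℚ-* 3 (suc n)) ⟨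
  ℕtoℚ (3 ℕ.* suc n) * (pochRatio n * r)      ≡⟨ Q.solve 3 (λ a b c → a Q.:* (b Q.:* c) Q.:= c Q.:* a Q.:* b) refl (ℕtoℚ (3 ℕ.* suc n)) (pochRatio n) r ⟩
  r * ℕtoℚ (3 ℕ.* suc n) * pochRatio n        ≡⟨ cong (_* pochRatio n) (/-*-cancel (3 ℕ.* n ℕ.+ 1) (n ℕ.+ 2 ℕ.* suc n)) ⟩
  ℕtoℚ (3 ℕ.* n ℕ.+ 1) * pochRatio n          ≡⟨ cong (_* pochRatio n) (trans (ℕtoℚ-+ (3 ℕ.* n) 1) (cong (_+ 1ℚ) (ℕtoℚ-* 3 n))) ⟩
  (ℕtoℚ 3 * ℕtoℚ n + 1ℚ) * pochRatio n        ∎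
  where
  open ≡-Reasoning
  r = (ℤ.+ (3 ℕ.* n ℕ.+ 1)) / (3 ℕ.* suc n)

-- The squared recurrence is (n+1)² p(n+1)² = (n+1/3)² p(n)², and the twist contributes -27 (n+1/3)²
-- = -27n² - 18n - 3.
F21-ode : let F = rescale F21 in
  θ (θ F) ≋ shiftUp (const (- ℕtoℚ 27) ⊗ θ (θ F) ⊕ const (- ℕtoℚ 18) ⊗ θ F ⊕ const (- ℕtoℚ 3) ⊗ F)
F21-ode .at zero    = *-zeroˡ (0ℚ * rescale F21 0)
F21-ode .at (suc n) = begin
  m′ * (m′ * (twist (suc n) * (p′ * p′)))
    ≡⟨ cong (λ z → m′ * (m′ * (z * (p′ * p′)))) (twist-suc n) ⟩
  m′ * (m′ * (- ℕtoℚ 27 * w * (p′ * p′)))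
    ≡⟨ Q.solve 3 (λ m w p → m Q.:* (m Q.:* (Q.con (- ℕtoℚ 27) Q.:* w Q.:* (p Q.:* p))) Q.:=
         Q.con (- ℕtoℚ 3) Q.:* w Q.:* ((Q.con (ℕtoℚ 3) Q.:* m Q.:* p) Q.:* (Q.con (ℕtoℚ 3) Q.:* m Q.:* p))) refl m′ w p′ ⟩
  - ℕtoℚ 3 * w * ((ℕtoℚ 3 * m′ * p′) * (ℕtoℚ 3 * m′ * p′))
    ≡⟨ cong (λ z → - ℕtoℚ 3 * w * (z * z)) (pochRatio-suc n) ⟩
  - ℕtoℚ 3 * w * (((ℕtoℚ 3 * m + 1ℚ) * p) * ((ℕtoℚ 3 * m + 1ℚ) * p))
    ≡⟨ Q.solve 3 (λ m w p → let u = (Q.con (ℕtoℚ 3) Q.:* m Q.:+ Q.con 1ℚ) Q.:* p ; F = w Q.:* (p Q.:* p) in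
         Q.con (- ℕtoℚ 3) Q.:* w Q.:* (u Q.:* u) Q.:=
         Q.con (- ℕtoℚ 27) Q.:* (m Q.:* (m Q.:* F)) Q.:+ Q.con (- ℕtoℚ 18) Q.:* (m Q.:* F) Q.:+ Q.con (- ℕtoℚ 3) Q.:* F) refl m w p ⟩
  - ℕtoℚ 27 * θ (θ F) n + - ℕtoℚ 18 * θ F n + - ℕtoℚ 3 * F n
    ≡⟨ cong₂ _+_ (cong₂ _+_ (const-⊛ (- ℕtoℚ 27) (θ (θ F)) n) (const-⊛ (- ℕtoℚ 18) (θ F) n)) (const-⊛ (- ℕtoℚ 3) F n) ⟨
  (const (- ℕtoℚ 27) ⊗ θ (θ F) ⊕ const (- ℕtoℚ 18) ⊗ θ F ⊕ const (- ℕtoℚ 3) ⊗ F) n ∎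
  where
  open ≡-Reasoning
  F = rescale F21
  m′ = ℕtoℚ (suc n)
  p′ = pochRatio (suc n)
  m = ℕtoℚ n
  p = pochRatio n
  w = twist n

-- Certificates for consequences of known equations: the solver verifies u = v + k (e - f) as a
-- polynomial identity, and e = f removes the correction. The cofactors `k` in the applications come
-- from matching the terms of u - v.
linear-consequence : ∀ {u v e f} k → e ≋ f → u ≋ v ⊕ k ⊗ (e ⊕ ⊝ f) → u ≋ v
linear-consequence {u} {v} {e} {f} k e≋f u≋ = ≋-trans u≋
  (≋-trans (⊕-cong (≋-refl {v}) (⊛-cong (≋-refl {k}) (⊕-cong e≋f (≋-refl {⊝ f}))))
    (S.solve 3 (λ v k f → v S.:+ k S.:* (f S.:- f) S.:= v) ≋-refl v k f))

linear-consequence₂ : ∀ {u v e f e′ f′} k k′ → e ≋ f → e′ ≋ f′ →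
  u ≋ v ⊕ k ⊗ (e ⊕ ⊝ f) ⊕ k′ ⊗ (e′ ⊕ ⊝ f′) → u ≋ v
linear-consequence₂ {v = v} {e} {f} k k′ e≋f e′≋f′ u≋ =
  linear-consequence k e≋f (linear-consequence {v = v ⊕ k ⊗ (e ⊕ ⊝ f)} k′ e′≋f′ u≋)

linear-consequence₃ : ∀ {u v e f e′ f′ e″ f″} k k′ k″ → e ≋ f → e′ ≋ f′ → e″ ≋ f″ →
  u ≋ v ⊕ k ⊗ (e ⊕ ⊝ f) ⊕ k′ ⊗ (e′ ⊕ ⊝ f′) ⊕ k″ ⊗ (e″ ⊕ ⊝ f″) → u ≋ v
linear-consequence₃ {v = v} {e} {f} {e′} {f′} k k′ k″ e≋f e′≋f′ e″≋f″ u≋ =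
  linear-consequence₂ k k′ e≋f e′≋f′ (linear-consequence {v = v ⊕ k ⊗ (e ⊕ ⊝ f) ⊕ k′ ⊗ (e′ ⊕ ⊝ f′)} k″ e″≋f″ u≋)

-- The differential system of level 3

θ-affine : ∀ c k f → θ (const c ⊕ const k ⊗ f) ≋ const k ⊗ θ f
θ-affine c k f = ≋-trans (θ-⊕ (const c) (const k ⊗ f)) (≋-trans (⊕-cong (θ-const c) (θ-const-⊗ k f))
  (S.solve 1 (λ f → S.con 0ℚ S.:+ f S.:= f) ≋-refl (const k ⊗ θ f)))

a s β W E : Series
a = const 1ℚ ⊕ const (frac 6 1) ⊗ L ⟪ 𝕩 ⟫
s = const 1ℚ ⊕ const (frac 12 1) ⊗ L ⟪ δ ⟫
β = const (- 1ℚ) ⊗ L ⟪ γ ⟫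
W = const 1ℚ ⊕ const (- frac 9 1) ⊗ L ⟪ 𝕩𝕕² ⟫
E = const 1ℚ ⊕ const (frac 3 1) ⊗ L ⟪ 𝕩𝕕⁴ ⟫

c : ∀ {n} → ℚ → S.Polynomial n
c = S.con

c2 c3 : ∀ {n} → S.Polynomial n
c2 = S.con (frac 2 1)
c3 = S.con (frac 3 1)

a²≋s : a ⊗ a ≋ s
a²≋s = linear-consequence (const (frac 18 1)) liouville-𝕩-𝕩
  -- `x′` repeats the shape of `lambert` on a one-element list, so that the Liouville identity
  -- enters as proved. The cofactor 18 turns its 2x² into the 36x² of `a ⊗ a`.
  (S.solve 2 (λ x δ → let x′ = c 1ℚ S.:* x S.:+ c 0ℚ ; a = c 1ℚ S.:+ c (frac 6 1) S.:* x in
    a S.:* a S.:= c 1ℚ S.:+ c (frac 12 1) S.:* δ S.:+ c (frac 18 1) S.:* (c2 S.:* (x′ S.:* x′) S.:-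
      (c 0ℚ S.:- (c (frac 2 3) S.:* x S.:+ (c (- frac 2 3) S.:* δ S.:+ c 0ℚ)))))
    ≋-refl (L ⟪ 𝕩 ⟫) (L ⟪ δ ⟫))

-- Classically a s = b³ + c³ and a β = θa - c³/3. Here c³ is the series that is out of reach of
-- Liouville's method, and the combination s + 3β is the one in which it cancels.
aκ≋W+3θa : a ⊗ (s ⊕ const (frac 3 1) ⊗ β) ≋ W ⊕ const (frac 3 1) ⊗ θ a
aκ≋W+3θa = ≋-trans (linear-consequence (const (- frac 9 2)) liouville-ψ-𝕩
  (S.solve 5 (λ x θx δ γ w → let x′ = c 1ℚ S.:* x S.:+ c 0ℚ in
    (c 1ℚ S.:+ c (frac 6 1) S.:* x) S.:* ((c 1ℚ S.:+ c (frac 12 1) S.:* δ) S.:+ c3 S.:* (c (- 1ℚ) S.:* γ)) S.:=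
    (c 1ℚ S.:+ c (- frac 9 1) S.:* w) S.:+ c3 S.:* (c (frac 6 1) S.:* θx) S.:+
    c (- frac 9 2) S.:* (c2 S.:* ((c2 S.:* γ S.:+ (c (- frac 8 1) S.:* δ S.:+ c 0ℚ)) S.:* x′) S.:-
      ((c (- frac 4 1) S.:* θx S.:+ c 0ℚ) S.:- (c (frac 2 3) S.:* γ S.:+ (c (- frac 8 3) S.:* δ S.:+ (c (- frac 4 3) S.:* x S.:+ (c (- frac 2 1) S.:* w S.:+ c 0ℚ)))))))
    ≋-refl (L ⟪ 𝕩 ⟫) (θ (L ⟪ 𝕩 ⟫)) (L ⟪ δ ⟫) (L ⟪ γ ⟫) (L ⟪ 𝕩𝕕² ⟫)))
  (⊕-cong (≋-refl {W}) (⊛-cong (≋-refl {const (frac 3 1)}) (≋-sym (θ-affine 1ℚ (frac 6 1) (L ⟪ 𝕩 ⟫)))))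

-- A Riccati equation; with `θs≋` it is a level-3 analogue of Ramanujan's differential equations for
-- Eisenstein series.
θβ≋ : θ β ≋ β ⊗ β ⊕ const (- frac 1 9) ⊗ L ⟪ η ⟫
θβ≋ = ≋-trans (θ-const-⊗ (- 1ℚ) (L ⟪ γ ⟫)) (linear-consequence (const (- frac 1 2)) liouville-γ-γ
  (S.solve 3 (λ γ θγ η → let γ′ = c 1ℚ S.:* γ S.:+ c 0ℚ ; β = c (- 1ℚ) S.:* γ in
    c (- 1ℚ) S.:* θγ S.:= β S.:* β S.:+ c (- frac 1 9) S.:* η S.:+
    c (- frac 1 2) S.:* (c2 S.:* (γ′ S.:* γ′) S.:- ((c (- frac 2 1) S.:* θγ S.:+ c 0ℚ) S.:- (c (- frac 2 9) S.:* η S.:+ c 0ℚ))))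
    ≋-refl (L ⟪ γ ⟫) (θ (L ⟪ γ ⟫)) (L ⟪ η ⟫)))

θs≋ : θ s ≋ const (frac 2 1) ⊗ β ⊗ s ⊕ const (frac 2 3) ⊗ L ⟪ η ⟫
θs≋ = ≋-trans (θ-affine 1ℚ (frac 12 1) (L ⟪ δ ⟫)) (linear-consequence (const (frac 4 1)) liouville-γ-δ
  (S.solve 4 (λ γ δ θδ η →
    c (frac 12 1) S.:* θδ S.:= c2 S.:* (c (- 1ℚ) S.:* γ) S.:* (c 1ℚ S.:+ c (frac 12 1) S.:* δ) S.:+ c (frac 2 3) S.:* η S.:+
    c (frac 4 1) S.:* (c2 S.:* ((c3 S.:* γ S.:+ c 0ℚ) S.:* (c 1ℚ S.:* δ S.:+ c 0ℚ)) S.:-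
      ((c (- frac 3 1) S.:* θδ S.:+ c 0ℚ) S.:- (c (frac 1 2) S.:* γ S.:+ (c (- frac 1 6) S.:* η S.:+ c 0ℚ)))))
    ≋-refl (L ⟪ γ ⟫) (L ⟪ δ ⟫) (θ (L ⟪ δ ⟫)) (L ⟪ η ⟫)))

dlog-W : W dlog const (frac 3 1) ⊗ β
dlog-W = by-dlog (≋-trans (θ-affine 1ℚ (- frac 9 1) (L ⟪ 𝕩𝕕² ⟫)) (linear-consequence (const (- frac 9 4)) liouville-γ-𝕩𝕕²
  (S.solve 3 (λ γ w θw →
    c (- frac 9 1) S.:* θw S.:= c3 S.:* (c (- 1ℚ) S.:* γ) S.:* (c 1ℚ S.:+ c (- frac 9 1) S.:* w) S.:+
    c (- frac 9 4) S.:* (c2 S.:* ((c (frac 6 1) S.:* γ S.:+ c 0ℚ) S.:* (c 1ℚ S.:* w S.:+ c 0ℚ)) S.:-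
      ((c (- frac 4 1) S.:* θw S.:+ c 0ℚ) S.:- (c (- frac 4 3) S.:* γ S.:+ c 0ℚ))))
    ≋-refl (L ⟪ γ ⟫) (L ⟪ 𝕩𝕕² ⟫) (θ (L ⟪ 𝕩𝕕² ⟫)))))

sW≋E : s ⊗ W ≋ E
sW≋E = linear-consequence (const (- frac 27 1)) liouville-δ-𝕩𝕕²
  (S.solve 3 (λ δ w e →
    (c 1ℚ S.:+ c (frac 12 1) S.:* δ) S.:* (c 1ℚ S.:+ c (- frac 9 1) S.:* w) S.:= c 1ℚ S.:+ c3 S.:* e S.:+
    c (- frac 27 1) S.:* (c2 S.:* ((c2 S.:* δ S.:+ c 0ℚ) S.:* (c 1ℚ S.:* w S.:+ c 0ℚ)) S.:-
      (c 0ℚ S.:- (c (frac 1 3) S.:* w S.:+ (c (frac 1 9) S.:* e S.:+ (c (- frac 4 9) S.:* δ S.:+ c 0ℚ))))))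
    ≋-refl (L ⟪ δ ⟫) (L ⟪ 𝕩𝕕² ⟫) (L ⟪ 𝕩𝕕⁴ ⟫))

-- Classically a = a(q), W = b(q)³ and y = c(q)³ for the cubic theta functions of Borwein and
-- Borwein, a³ = b³ + c³; s and β are the logarithmic derivatives of t and of b.
y : Series
y = const (frac 3 1) ⊗ (θ a ⊕ ⊝ (a ⊗ β))

-- The Borwein identity: put s = a² into a (s + 3β) = W + 3 θa; the terms containing `β` and `θ a`
-- are exactly `y`.
W≋a³-y : W ≋ a ⊗ a ⊗ a ⊕ ⊝ y
W≋a³-y = linear-consequence₂ (const (- 1ℚ)) a aκ≋W+3θa (≋-sym a²≋s)
  (S.solve 5 (λ a θa s β w → w S.:= a S.:* a S.:* a S.:- c3 S.:* (θa S.:- a S.:* β) S.:+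
      c (- 1ℚ) S.:* (a S.:* (s S.:+ c3 S.:* β) S.:- (w S.:+ c3 S.:* θa)) S.:+ a S.:* (s S.:- a S.:* a))
    ≋-refl a (θ a) s β W)

-- The derivative of a² = s, computed as 2a θa and from the equation for `θ s`, determines a (θa -
-- aβ).
ay≋η : a ⊗ y ≋ L ⟪ η ⟫
ay≋η = linear-consequence₂ (const (frac 3 2)) (const (- frac 3 1) ⊗ β)
  (≋-trans (≋-sym (θ-⊗ a a)) (≋-trans (θ-cong a²≋s) θs≋)) a²≋s
  (S.solve 5 (λ a θa s β h → a S.:* (c3 S.:* (θa S.:- a S.:* β)) S.:= h S.:+
      c (frac 3 2) S.:* (θa S.:* a S.:+ a S.:* θa S.:- (c2 S.:* β S.:* s S.:+ c (frac 2 3) S.:* h)) S.:+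
      c (- frac 3 1) S.:* β S.:* (a S.:* a S.:- s))
    ≋-refl a (θ a) s β (L ⟪ η ⟫))

-- Differentiate y = a³ - W with θa = y/3 + aβ and θW = 3βW; the terms in `β` recombine to 3βy, and
-- the rest is a² y = s y.
dlog-y : y dlog s ⊕ const (frac 3 1) ⊗ β
dlog-y = by-dlog (≋-trans (θ-cong y≋) (≋-trans θ-expand
  (linear-consequence₂ (const (- frac 3 1) ⊗ β) y W≋a³-y a²≋s
    (S.solve 5 (λ a θa s β w → let y = c3 S.:* (θa S.:- a S.:* β) in
        (θa S.:* a S.:+ a S.:* θa) S.:* a S.:+ a S.:* a S.:* θa S.:- c3 S.:* β S.:* w S.:=
        (s S.:+ c3 S.:* β) S.:* y S.:+
        c (- frac 3 1) S.:* β S.:* (w S.:- (a S.:* a S.:* a S.:- y)) S.:+ y S.:* (a S.:* a S.:- s))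
      ≋-refl a (θ a) s β W))))
  where
  y≋ : y ≋ a ⊗ a ⊗ a ⊕ ⊝ W
  y≋ = linear-consequence (const 1ℚ) W≋a³-y
    (S.solve 3 (λ a y w → y S.:= a S.:* a S.:* a S.:- w S.:+ c 1ℚ S.:* (w S.:- (a S.:* a S.:* a S.:- y))) ≋-refl a y W)
  θ-expand : θ (a ⊗ a ⊗ a ⊕ ⊝ W) ≋ (θ a ⊗ a ⊕ a ⊗ θ a) ⊗ a ⊕ a ⊗ a ⊗ θ a ⊕ ⊝ (const (frac 3 1) ⊗ β ⊗ W)
  θ-expand = ≋-trans (θ-⊕ (a ⊗ a ⊗ a) (⊝ W)) (⊕-cong
    (≋-trans (θ-⊗ (a ⊗ a) a) (⊕-cong (⊛-cong (θ-⊗ a a) (≋-refl {a})) (≋-refl {a ⊗ a ⊗ θ a})))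
    (≋-trans (θ-⊝ W) (⊝-cong (dlog-W .θ-dlog))))

-- t/q
R : Series
R = etaProdPos 3 12 ⊛ etaProdNeg 1 12

-- Identification of the eta quotients

ηlog-1-3 : ηlog 1 ≋ L ⟪ δ ⟫ ⊕ ηlog 3
ηlog-1-3 = ≋-trans ηlog-1 (≋-trans (L-cong {ℕtoℚ} {⟪ δ +ₚ ε ⟫}
    (λ n → normalise-sound (𝕕 (residue n)) ((δ +ₚ ε) (residue n)) (each {P = λ r → Q.normalise (𝕕 r) ≡ Q.normalise ((δ +ₚ ε) r)} refl refl refl (residue n)) (ℕtoℚ n ∷ [])))
  (≋-trans (L-+ ⟪ δ ⟫ ⟪ ε ⟫) (⊕-cong (≋-refl {L ⟪ δ ⟫}) (≋-sym ηlog-3))))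

γ≋ηlog : L ⟪ γ ⟫ ≋ const (frac 3 1) ⊗ ηlog 1 ⊕ const (- 1ℚ) ⊗ ηlog 3
γ≋ηlog = ≋-trans (L-cong {⟪ γ ⟫} {⟪ frac 3 1 · 𝕕 +ₚ - 1ℚ · ε ⟫}
    (λ n → normalise-sound (γ (residue n)) ((frac 3 1 · 𝕕 +ₚ - 1ℚ · ε) (residue n))
      (each {P = λ r → Q.normalise (γ r) ≡ Q.normalise ((frac 3 1 · 𝕕 +ₚ - 1ℚ · ε) r)} refl refl refl (residue n)) (ℕtoℚ n ∷ [])))
  (≋-trans (L-+ ⟪ frac 3 1 · 𝕕 ⟫ ⟪ - 1ℚ · ε ⟫) (⊕-cong
    (≋-trans (L-* (frac 3 1) ⟪ 𝕕 ⟫) (⊛-cong (≋-refl {const (frac 3 1)}) (≋-sym ηlog-1)))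
    (≋-trans (L-* (- 1ℚ) ⟪ ε ⟫) (⊛-cong (≋-refl {const (- 1ℚ)}) (≋-sym ηlog-3)))))

dlog-R : R dlog s ⊕ ⊝ oneS
dlog-R = dlog-congʳ {R} (linear-consequence₂ (const (frac 12 1)) (const 1ℚ) ηlog-1-3 oneS≋const
    (S.solve 4 (λ p q δ o → c (- frac 12 1) S.:* q S.:+ c (frac 12 1) S.:* p S.:=
        (c 1ℚ S.:+ c (frac 12 1) S.:* δ) S.:- o S.:+ c (frac 12 1) S.:* (p S.:- (δ S.:+ q)) S.:+ c 1ℚ S.:* (o S.:- c 1ℚ))
      ≋-refl (ηlog 1) (ηlog 3) (L ⟪ δ ⟫) oneS))
  (dlog-⊗ {etaProdPos 3 12} {etaProdNeg 1 12} (dlog-etaProdPos 2 12) (dlog-etaProdNeg 0 12))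

dlog-t : tS dlog s
dlog-t = dlog-congʳ {tS} (S.solve 2 (λ o s → o S.:+ (s S.:- o) S.:= s) ≋-refl oneS s) (dlog-shiftUp {R} dlog-R)

dlog-etaQuot : etaQuot dlog const (frac 3 1) ⊗ β
dlog-etaQuot = dlog-congʳ {etaQuot} (linear-consequence (const (frac 3 1)) γ≋ηlog
    (S.solve 3 (λ p q γ → c (- frac 9 1) S.:* p S.:+ c3 S.:* q S.:=
        c3 S.:* (c (- 1ℚ) S.:* γ) S.:+ c3 S.:* (γ S.:- (c3 S.:* p S.:+ c (- 1ℚ) S.:* q))) ≋-refl (ηlog 1) (ηlog 3) (L ⟪ γ ⟫)))
  (dlog-⊗ {etaProdPos 1 9} {etaProdNeg 3 3} (dlog-etaProdPos 0 9) (dlog-etaProdNeg 2 3))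

W≋etaQuot : W ≋ etaQuot
W≋etaQuot = first-order-unique {ℓ = const (frac 3 1) ⊗ β} refl dlog-W dlog-etaQuot refl

dlog-const-⊗ : ∀ k {f ℓ} → f dlog ℓ → const k ⊗ f dlog ℓ
dlog-const-⊗ k {f} {ℓ} df = by-dlog (≋-trans (θ-const-⊗ k f) (≋-trans (⊛-cong (≋-refl {const k}) (df .θ-dlog))
  (S.solve 3 (λ k ℓ f → k S.:* (ℓ S.:* f) S.:= ℓ S.:* (k S.:* f)) ≋-refl (const k) ℓ f)))

dlog-shiftDown : ∀ {f ℓ} → f 0 ≡ 0ℚ → f dlog ℓ → shiftDown f dlog ℓ ⊕ ⊝ oneS
dlog-shiftDown {f} {ℓ} f₀ df = by-dlog (begin
  θ f′                     ≈⟨ pointwise (λ n → trans (Q.solve 2 (λ n x → n Q.:* x Q.:= (Q.con 1ℚ Q.:+ n) Q.:* x Q.:- x) refl (ℕtoℚ n) (f (suc n)))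
                                (cong (_- f (suc n)) (trans (cong (_* f (suc n)) (sym (ℕtoℚ-suc n))) (shifted n)))) ⟩
  ℓ ⊗ f′ ⊕ ⊝ f′            ≈⟨ ⊕-cong (≋-refl {ℓ ⊗ f′}) (⊝-cong (≋-sym (⊛-identityˡ f′))) ⟩
  ℓ ⊗ f′ ⊕ ⊝ (oneS ⊗ f′)   ≈⟨ S.solve 3 (λ ℓ f o → ℓ S.:* f S.:- o S.:* f S.:= (ℓ S.:- o) S.:* f) ≋-refl ℓ f′ oneS ⟩
  (ℓ ⊕ ⊝ oneS) ⊗ f′        ∎)
  where
  open ≋-Reasoning
  f′ = shiftDown f
  shifted : ∀ n → θ f (suc n) ≡ (ℓ ⊗ f′) n
  shifted n = trans (df .θ-dlog .at (suc n)) (trans (⊛-suc′ ℓ f n)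
    (trans (cong ((ℓ ⊗ f′) n +_) (trans (cong (ℓ (suc n) *_) f₀) (*-zeroʳ (ℓ (suc n))))) (+-identityʳ ((ℓ ⊗ f′) n))))

-- Both sides have logarithmic derivative s + 3β. Its constant term is 1, so both are divided by q
-- before the uniqueness lemma is applied.
y≋27tW : y ≋ const (frac 27 1) ⊗ (tS ⊗ W)
y≋27tW = begin
  y                                       ≈⟨ pointwise (λ { zero → refl ; (suc n) → refl }) ⟩
  shiftUp (shiftDown y)                   ≈⟨ shiftUp-cong tail ⟩
  shiftUp (const (frac 27 1) ⊗ (R ⊗ W))   ≈⟨ shiftUp-cong (S.solve 3 (λ k r w → k S.:* (r S.:* w) S.:= r S.:* (k S.:* w)) ≋-refl (const (frac 27 1)) R W) ⟩
  shiftUp (R ⊗ (const (frac 27 1) ⊗ W))   ≈⟨ shiftUp-⊛ R (const (frac 27 1) ⊗ W) ⟨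
  tS ⊗ (const (frac 27 1) ⊗ W)            ≈⟨ S.solve 3 (λ k r w → r S.:* (k S.:* w) S.:= k S.:* (r S.:* w)) ≋-refl (const (frac 27 1)) tS W ⟩
  const (frac 27 1) ⊗ (tS ⊗ W)            ∎
  where
  open ≋-Reasoning
  tail : shiftDown y ≋ const (frac 27 1) ⊗ (R ⊗ W)
  tail = first-order-unique {ℓ = s ⊕ const (frac 3 1) ⊗ β ⊕ ⊝ oneS} refl (dlog-shiftDown {y} refl dlog-y)
    (dlog-const-⊗ (frac 27 1) {R ⊗ W} (dlog-congʳ {R ⊗ W}
      (S.solve 3 (λ s o b → s S.:- o S.:+ b S.:= s S.:+ b S.:- o) ≋-refl s oneS (const (frac 3 1) ⊗ β)) (dlog-⊗ {R} {W} dlog-R dlog-W)))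
    -- Here the constant 27 is fixed: a = 1 + 6q + ... and β = -3q - ..., so the coefficient of q in
    -- `y` is 3 (6 + 3).
    refl

-- By a² = s this is a⁴ = a (W + y) with y = 27tW; the factor 1 + 27t is the leading coefficient of
-- the hypergeometric equation.
s²≋ : s ⊗ s ≋ a ⊗ W ⊗ (const 1ℚ ⊕ const (frac 27 1) ⊗ tS)
s²≋ = linear-consequence₃ (⊝ (a ⊗ a ⊕ s)) (⊝ a) a a²≋s W≋a³-y y≋27tW
  (S.solve 5 (λ a s w y t → s S.:* s S.:= a S.:* w S.:* (c 1ℚ S.:+ c (frac 27 1) S.:* t) S.:+
      (S.:- (a S.:* a S.:+ s)) S.:* (a S.:* a S.:- s) S.:+
      (S.:- a) S.:* (w S.:- (a S.:* a S.:* a S.:- y)) S.:+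
      a S.:* (y S.:- c (frac 27 1) S.:* (t S.:* w)))
    ≋-refl a s W y tS)

η≋ : L ⟪ η ⟫ ≋ const (frac 27 1) ⊗ (a ⊗ (tS ⊗ W))
η≋ = linear-consequence₂ (const (- 1ℚ)) a ay≋η y≋27tW
  (S.solve 5 (λ a h w y t → h S.:= c (frac 27 1) S.:* (a S.:* (t S.:* w)) S.:+
      c (- 1ℚ) S.:* (a S.:* y S.:- h) S.:+ a S.:* (y S.:- c (frac 27 1) S.:* (t S.:* w)))
    ≋-refl a (L ⟪ η ⟫) W y tS)

-- The hypergeometric function of t

Φ Φ₁ Φ₂ : Series
Φ  = compose R (rescale F21)
Φ₁ = compose R (θ (rescale F21))
Φ₂ = compose R (θ (θ (rescale F21)))

Φ-ode : Φ₂ ≋ tS ⊗ (const (- ℕtoℚ 27) ⊗ Φ₂ ⊕ const (- ℕtoℚ 18) ⊗ Φ₁ ⊕ const (- ℕtoℚ 3) ⊗ Φ)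
Φ-ode = ≋-trans (compose-cong R F21-ode) (≋-trans (compose-shiftUp R (p ⊕ q ⊕ r)) (⊛-cong (≋-refl {tS})
  (≋-trans (compose-⊕ R (p ⊕ q) r) (⊕-cong
    (≋-trans (compose-⊕ R p q) (⊕-cong (compose-const-⊗ R (- ℕtoℚ 27) (θ (θ F))) (compose-const-⊗ R (- ℕtoℚ 18) (θ F))))
    (compose-const-⊗ R (- ℕtoℚ 3) F)))))
  where
  F = rescale F21
  p = const (- ℕtoℚ 27) ⊗ θ (θ F)
  q = const (- ℕtoℚ 18) ⊗ θ F
  r = const (- ℕtoℚ 3) ⊗ F

-- The hypergeometric equation for Φ and the Riccati equation θβ≋ for β make w = θΦ - βΦ a
-- solution of θ w = β w, and w vanishes at q = 0.
dlog-Φ : Φ dlog β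
dlog-Φ = by-dlog (≋-trans (θ-compose R dlog-t (rescale F21)) (linear-consequence (const 1ℚ) w≋0
  (S.solve 4 (λ s f₁ β f → s S.:* f₁ S.:= β S.:* f S.:+ c 1ℚ S.:* (s S.:* f₁ S.:- β S.:* f S.:- c 0ℚ)) ≋-refl s Φ₁ β Φ)))
  where
  w : Series
  w = s ⊗ Φ₁ ⊕ ⊝ (β ⊗ Φ)

  θw : θ w ≋ (const (frac 2 1) ⊗ β ⊗ s ⊕ const (frac 2 3) ⊗ L ⟪ η ⟫) ⊗ Φ₁ ⊕ s ⊗ (s ⊗ Φ₂) ⊕
             ⊝ ((β ⊗ β ⊕ const (- frac 1 9) ⊗ L ⟪ η ⟫) ⊗ Φ ⊕ β ⊗ (s ⊗ Φ₁))
  θw = ≋-trans (θ-⊕ (s ⊗ Φ₁) (⊝ (β ⊗ Φ))) (⊕-cong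
    (≋-trans (θ-⊗ s Φ₁) (⊕-cong (⊛-cong θs≋ (≋-refl {Φ₁})) (⊛-cong (≋-refl {s}) (θ-compose R dlog-t (θ (rescale F21))))))
    (≋-trans (θ-⊝ (β ⊗ Φ)) (⊝-cong (≋-trans (θ-⊗ β Φ)
      (⊕-cong (⊛-cong θβ≋ (≋-refl {Φ})) (⊛-cong (≋-refl {β}) (θ-compose R dlog-t (rescale F21))))))))

  dlog-w : w dlog β
  -- Beyond β w there remains s² Φ₂ + (2/3) H Φ₁ + (1/9) H Φ with H = `L ⟪ η ⟫`. By `s²≋` and `η≋`
  -- this is aW ((1+27t) Φ₂ + 18t Φ₁ + 3t Φ), which vanishes by `Φ-ode`.
  dlog-w = by-dlog (≋-trans θw (linear-consequence₃ Φ₂ (const (frac 2 3) ⊗ Φ₁ ⊕ const (frac 1 9) ⊗ Φ) (a ⊗ W) s²≋ η≋ Φ-ode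
    (S.solve 9 (λ s β h f f₁ f₂ a w t →
      (c2 S.:* β S.:* s S.:+ c (frac 2 3) S.:* h) S.:* f₁ S.:+ s S.:* (s S.:* f₂) S.:-
        ((β S.:* β S.:+ c (- frac 1 9) S.:* h) S.:* f S.:+ β S.:* (s S.:* f₁))
      S.:= β S.:* (s S.:* f₁ S.:- β S.:* f) S.:+
        f₂ S.:* (s S.:* s S.:- a S.:* w S.:* (c 1ℚ S.:+ c (frac 27 1) S.:* t)) S.:+
        (c (frac 2 3) S.:* f₁ S.:+ c (frac 1 9) S.:* f) S.:* (h S.:- c (frac 27 1) S.:* (a S.:* (t S.:* w))) S.:+
        a S.:* w S.:* (f₂ S.:- t S.:* (c (- ℕtoℚ 27) S.:* f₂ S.:+ c (- ℕtoℚ 18) S.:* f₁ S.:+ c (- ℕtoℚ 3) S.:* f)))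
      ≋-refl s β (L ⟪ η ⟫) Φ Φ₁ Φ₂ a W tS)))

  w≋0 : w ≋ const 0ℚ
  w≋0 = first-order-unique-0 {w} {β} refl dlog-w refl

BofT≋Φ³ : BofT ≋ powS Φ 3
BofT≋Φ³ = ≋-trans (compose-cong R B≋) (compose-powS R (rescale F21) 3)

BofT≋etaQuot : BofT ≋ etaQuot
BofT≋etaQuot = ≋-trans BofT≋Φ³ (first-order-unique {ℓ = const (frac 3 1) ⊗ β} refl (dlog-powS {Φ} 3 dlog-Φ) dlog-etaQuot refl)

-- Multiplicative inverses

lookupD-++ˡ : ∀ xs ys n → n < length xs → lookupD (xs ++ ys) n ≡ lookupD xs n
lookupD-++ˡ (x ∷ xs) ys zero    _         = refl
lookupD-++ˡ (x ∷ xs) ys (suc n) (s≤s n<l) = lookupD-++ˡ xs ys n n<l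

lookupD-++-length : ∀ xs z → lookupD (xs ++ z ∷ []) (length xs) ≡ z
lookupD-++-length []       z = refl
lookupD-++-length (x ∷ xs) z = lookupD-++-length xs z

length-invList : ∀ u n → length (invList u n) ≡ suc n
length-invList u zero    = refl
length-invList u (suc n) = trans (length-++ (invList u n)) (trans (cong (ℕ._+ 1) (length-invList u n)) (ℕₚ.+-comm (suc n) 1))

-- Each list extends the preceding one, so an entry keeps its value once computed; this recovers the
-- recursion for the inverse from its list implementation.
lookupD-invList : ∀ u {k n} → k ≤ n → lookupD (invList u n) k ≡ invUnit u k
lookupD-invList u {k} {zero}  z≤n = refl
lookupD-invList u {k} {suc n} k≤1+n with k ℕ.≟ suc n
... | yes refl = refl
... | no k≢1+n = trans (lookupD-++ˡ (invList u n) _ k (subst (k <_) (sym (length-invList u n)) (s≤s k≤n))) (lookupD-invList u k≤n)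
  where k≤n = ℕₚ.≤-pred (ℕₚ.≤∧≢⇒< k≤1+n k≢1+n)

invUnit-suc : ∀ u n → invUnit u (suc n) ≡ - sum1To (suc n) (λ k → u k * invUnit u (suc n ∸ k))
invUnit-suc u n = trans (cong (lookupD (invList u (suc n))) (sym (length-invList u n)))
  (trans (lookupD-++-length (invList u n) _)
    (cong -_ (sum1To-cong (suc n) (λ k _ → cong (u (suc k) *_) (lookupD-invList u (ℕₚ.m∸n≤m n k))))))

sumTo≡sum1To : ∀ n f → sumTo n f ≡ f 0 + sum1To n f
sumTo≡sum1To zero    f = sym (+-identityʳ (f 0))
sumTo≡sum1To (suc n) f = trans (cong (_+ f (suc n)) (sumTo≡sum1To n f)) (+-assoc (f 0) (sum1To n f) (f (suc n)))

⊛-inverseʳ : ∀ u → u 0 ≡ 1ℚ → u ⊛ invUnit u ≋ oneS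
⊛-inverseʳ u u₀ .at zero    = trans (*-identityʳ (u 0)) u₀
⊛-inverseʳ u u₀ .at (suc n) = begin
  sumTo (suc n) (λ k → u k * v (suc n ∸ k))   ≡⟨ sumTo≡sum1To (suc n) (λ k → u k * v (suc n ∸ k)) ⟩
  u 0 * v (suc n) + z                         ≡⟨ cong (_+ z) (trans (cong (_* v (suc n)) u₀) (trans (*-identityˡ (v (suc n))) (invUnit-suc u n))) ⟩
  - z + z                                     ≡⟨ +-inverseˡ z ⟩
  0ℚ                                          ∎
  where
  open ≡-Reasoning
  v = invUnit u
  z = sum1To (suc n) (λ k → u k * v (suc n ∸ k))

-- Degree n of dt/dq is degree n + 1 of θ t = s t, and removing one factor q from t leaves `R`.
derivS-t : derivS tS ≋ R ⊗ s
derivS-t .at n = trans (dlog-t .θ-dlog .at (suc n)) (trans (⊛-comm s tS .at (suc n)) (shiftUp-⊛ R s .at (suc n)))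

CS≋E : CS ≋ E
CS≋E = begin
  BofT ⊗ v ⊗ derivS tS     ≈⟨ ⊛-cong (⊛-cong (≋-trans BofT≋etaQuot (≋-sym W≋etaQuot)) (≋-refl {v})) derivS-t ⟩
  W ⊗ v ⊗ (R ⊗ s)          ≈⟨ S.solve 4 (λ w v r s → w S.:* v S.:* (r S.:* s) S.:= (r S.:* v) S.:* (s S.:* w)) ≋-refl W v R s ⟩
  R ⊗ v ⊗ (s ⊗ W)          ≈⟨ ⊛-cong (⊛-inverseʳ R refl) sW≋E ⟩
  oneS ⊗ E                 ≈⟨ ⊛-identityˡ E ⟩
  E                        ∎
  where
  open ≋-Reasoning
  v = invUnit (shiftDown tS)

-- Divisor sums

χ3-% : ∀ m n → m ℕ.% 3 ≡ n ℕ.% 3 → χ3 m ≡ χ3 n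
χ3-% m n eq with m ℕ.% 3 | n ℕ.% 3 | eq
... | 0                 | .0                 | refl = refl
... | 1                 | .1                 | refl = refl
... | 2                 | .2                 | refl = refl
... | suc (suc (suc r)) | .(suc (suc (suc r))) | refl = refl

χ3≡χ : ∀ n → χ3 n ≡ χ (residue n)
χ3≡χ 0 = refl
χ3≡χ 1 = refl
χ3≡χ 2 = refl
χ3≡χ (suc (suc (suc n))) = trans
  (χ3-% (3 ℕ.+ n) n (trans (cong (ℕ._% 3) (ℕₚ.+-comm 3 n)) ([m+n]%n≡m%n n 3)))
  (trans (χ3≡χ n) (cong χ (sym (next³ (residue n)))))
  where
  next³ : ∀ r → next (next (next r)) ≡ r
  next³ = each refl refl refl

𝕩𝕕⁴-value : ∀ n → ⟪ 𝕩𝕕⁴ ⟫ n ≡ χ3 n * ℕtoℚ (n ℕ.^ 4)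
𝕩𝕕⁴-value n = cong₂ _*_ (sym (χ3≡χ n)) (sym (begin
  ℕtoℚ (n ℕ.* (n ℕ.* (n ℕ.* (n ℕ.* 1))))   ≡⟨ trans (ℕtoℚ-* n _) (cong (m *_) (trans (ℕtoℚ-* n _) (cong (m *_) (trans (ℕtoℚ-* n _) (cong (m *_) (ℕtoℚ-* n 1)))))) ⟩
  m * (m * (m * (m * 1ℚ)))                 ≡⟨ Q.solve 1 (λ m → m Q.:* (m Q.:* (m Q.:* (m Q.:* Q.con 1ℚ))) Q.:= m Q.:* m Q.:* m Q.:* m) refl m ⟩
  m * m * m * m                            ∎))
  where
  open ≡-Reasoning
  m = ℕtoℚ n

-- The summand of divSum n is local to its definition; unification recovers it.
divSum-summand : ∀ n → ∃ λ f → divSum n ≡ sum1To n f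
divSum-summand n = _ , refl

-- In positive degree the coefficient of `G d` is the indicator of divisibility, so both sides
-- branch on the same test.
divSum-term : ∀ n d → ⟪ 𝕩𝕕⁴ ⟫ d * G d (suc n) ≡ proj₁ (divSum-summand (suc n)) d
divSum-term n d with d ∣? suc n
... | yes _ = trans (*-identityʳ (⟪ 𝕩𝕕⁴ ⟫ d)) (𝕩𝕕⁴-value d)
... | no _  = *-zeroʳ (⟪ 𝕩𝕕⁴ ⟫ d)

divSum≡L : ∀ n → L ⟪ 𝕩𝕕⁴ ⟫ (suc n) ≡ divSum (suc n)
divSum≡L n = sum1To-cong (suc n) (λ k _ → divSum-term n (suc k))

E-suc : ∀ n → E (suc n) ≡ frac 3 1 * divSum (suc n)
E-suc n = trans (+-identityˡ _) (trans (const-⊛ (frac 3 1) (L ⟪ 𝕩𝕕⁴ ⟫) (suc n)) (cong (frac 3 1 *_) (divSum≡L n)))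

open import Data.Integer using (+_)

theorem3p1 : (∀ N → BofT N ≡ etaQuot N)
    × (∀ n → CS n ≡ ((+ 3) / 1) * E5 n)
    × (CS 0 ≡ 1ℚ)
    × (∀ n → CS (suc n) ≡ ((+ 3) / 1) * divSum (suc n))
theorem3p1 = BofT≋etaQuot .at
  -- In degree 0 the value 3 (1/3) and the constant term of `E` both compute to 1.
  , (λ { zero    → CS≋E .at 0
       ; (suc n) → trans (CS≋E .at (suc n)) (E-suc n) })
  , CS≋E .at 0
  , λ n → trans (CS≋E .at (suc n)) (E-suc n)
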